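{- Let $t$ be a positive integer and let $d=2^{2t+1}$. Then there exists a set of $d$ mutually quasi-unbiased weighing matrices for parameters $(d,d,d/2,2d)$; that is, there exist weighing matrices $W_1,\ldots,W_d$ of order $d$ and weight $d$ such that for all distinct $i,j$ the matrix $\frac{1}{\sqrt{2d}}W_iW_j^T$ is a weighing matrix of order $d$ and weight $d/2$.
   Context: A weighing matrix of order $d$ and weight $k$ is a square $d\times d$ matrix $W$ with entries in $\{0,1,-1\}$ such that $WW^T=kI$. Two weighing matrices $W_1,W_2$ of order $d$ and weight $k$ are quasi-unbiased for parameters $(d,k,l,a)$ (with $a,l$ positive integers) if $\frac{1}{\sqrt a}W_1W_2^T$ is a weighing matrix of weight $l$ (necessarily $l=k^2/a$). A set of weighing matrices is a set of mutually quasi-unbiased weighing matrices (MQUWM) for parameters $(d,k,l,a)$ if any two distinct members are quasi-unbiased for parameters $(d,k,l,a)$. -}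

module Defs where

open import Data.Nat using (ℕ; zero; suc)
open import Data.Fin using (Fin; zero; suc)
open import Data.Integer using (ℤ; +_; _+_; _*_; -_; 0ℤ; 1ℤ)
open import Data.Sum using (_⊎_)
open import Data.Product using (Σ; _×_)
open import Relation.Binary.PropositionalEquality using (_≡_)
open import Relation.Nullary using (¬_)

Matrix : ℕ → Set
Matrix d = Fin d → Fin d → ℤ

∑ : ∀ {n} → (Fin n → ℤ) → ℤ
∑ {zero}  f = 0ℤ
∑ {suc n} f = f zero + ∑ (λ i → f (suc i))

transpose : ∀ {d} → Matrix d → Matrix d
transpose A i j = A j i

_·_ : ∀ {d} → Matrix d → Matrix d → Matrix d
(A · B) i j = ∑ (λ m → A i m * B m j)

scale : ∀ {d} → ℤ → Matrix d → Matrix d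
scale c A i j = c * A i j

scalarId : ∀ {d} → ℤ → Matrix d
scalarId {d} k i j with Data.Fin._≟_ i j
... | Relation.Nullary.yes _ = k
... | Relation.Nullary.no _ = 0ℤ

Trit : ℤ → Set
Trit x = (x ≡ 0ℤ) ⊎ ((x ≡ 1ℤ) ⊎ (x ≡ - 1ℤ))

IsWeighing : (d k : ℕ) → Matrix d → Set
IsWeighing d k W =
  (∀ i j → Trit (W i j)) × (∀ i j → (W · transpose W) i j ≡ scalarId (+ k) i j)

-- quasi-unbiased for (d,k,l,a): (1/√a) W₁ W₂ᵀ is a weighing matrix of weight l.
-- Equivalently: W₁ W₂ᵀ = s · M with s ≥ 0, s² = a (s = √a) and M a weighing
-- matrix of order d and weight l.  (If the product has an integer entry equal
-- to √a·(±1), √a is forced to be a (non-negative) integer s.)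
QuasiUnbiased : (d k l a : ℕ) → Matrix d → Matrix d → Set
QuasiUnbiased d k l a W₁ W₂ =
  Σ ℕ λ s → (s Data.Nat.* s ≡ a) × Σ (Matrix d) λ M →
    IsWeighing d l M × (∀ i j → (W₁ · transpose W₂) i j ≡ scale (+ s) M i j)

IsMQUWM : (n d k l a : ℕ) → (Fin n → Matrix d) → Set
IsMQUWM n d k l a W =
  (∀ i → IsWeighing d k (W i)) ×
  (∀ i j → ¬ (i ≡ j) → QuasiUnbiased d k l a (W i) (W j))

module Submission where

-- Write q = 2^m with m = 2t + 1, and let χ = (−1)^Tr be the canonical additive character of
-- 𝔽_q.  The matrices are W_a(u, z) = χ(a z³ + u z), so that W_a W_bᵀ has the entries
-- S(u + v), where S(u) = Σ_z χ(c z³ + u z) and c = a + b.  Squaring the sum and using that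
-- the cubic term has an alternating polar form gives S(u)² = q Σ_w χ(c w³ + u w), where w
-- ranges over the radical {w : w = 0 or c w³ = 1}.  Cubing is bijective because m is odd,
-- so the radical has two elements and S(u)² is 0 or 2q when c ≠ 0.
--
-- The field itself is obtained as follows.  Put N = q − 1.  Every element of the finite ring
-- R = 𝔽₂[x]/(x^N − 1) satisfies r^q = r, hence R is von Neumann regular.  The element
-- y = ∏_{0<d<m} (x^(2^d) − x) is monic of degree 2^m − 2 < N in x, so it is nonzero and some
-- primitive idempotent e lies below the idempotent of y.  In the field eR the conjugates
-- x^(2^i), i < m, are distinct; so no nonzero polynomial over 𝔽₂ of degree < m vanishes at
-- x, and the 2^m values of these polynomials are all the roots of X^q − X, i.e. all of eR.

open import Algebra.Bundles using (RawRing; CommutativeRing; CommutativeSemigroup)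
open import Algebra.Core using (Op₂)
open import Algebra.Structures using (IsAbelianGroup; IsCommutativeRing)
open import Data.Bool using (Bool; true; false; _xor_; _∧_; if_then_else_)
import Data.Bool.Properties as 𝔹ₚ
open import Data.Fin as Fin using (Fin; zero; suc; toℕ)
import Data.Fin.Properties as Finₚ
open import Data.List as List using (List; []; _∷_; _++_)
open import Data.List.Membership.Propositional using (_∈_)
open import Data.List.Membership.Propositional.Properties using (∈-++⁺ˡ; ∈-++⁺ʳ; ∈-map⁺)
open import Data.List.Relation.Unary.All as All using (All; []; _∷_)
open import Data.List.Relation.Unary.Any using (here)
open import Data.Maybe using (just; nothing)
open import Data.Nat as ℕ using (ℕ; zero; suc; s≤s; z≤n)
import Data.Nat.DivMod as DivMod
import Data.Nat.Properties as ℕₚ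
open import Data.Product using (∃; _×_; _,_; proj₁; proj₂)
open import Data.Sum as Sum using (_⊎_; inj₁; inj₂)
open import Data.Vec as Vec using (Vec; []; _∷_; replicate; zipWith)
import Data.Vec.Properties as Vecₚ
open import Function using (id; _∘_)
open import Relation.Binary.Definitions using (DecidableEquality; WeaklyDecidable; tri<; tri≈; tri>)
open import Relation.Binary.PropositionalEquality hiding ([_])
open import Relation.Nullary using (Dec; yes; no; contradiction)
open import Relation.Nullary.Decidable using (does; ¬?; dec-true; dec-false; decidable-stable)

-- Commutative rings of characteristic 2

-- Characteristic 2 is encoded by negation being the identity.
record Char2Ring (A : Set) : Set where
  infixl 6 _+_
  infixl 7 _*_
  field
    _+_ _*_ : Op₂ A
    0# 1#   : A
    isCommutativeRing : IsCommutativeRing _≡_ _+_ _*_ id 0# 1#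

  commutativeRing : CommutativeRing _ _
  commutativeRing = record { isCommutativeRing = isCommutativeRing }

  open IsCommutativeRing isCommutativeRing public
    using (+-assoc; +-comm; +-identityˡ; +-identityʳ; *-assoc; *-comm; *-identityˡ; *-identityʳ;
           distribˡ; distribʳ; zeroˡ; zeroʳ)
    renaming (-‿inverseʳ to x+x≡0)

  [_] : Bool → A
  [ false ] = 0#
  [ true  ] = 1#

module Char2 {A : Set} (R : Char2Ring A) where
  open Char2Ring R public
  open ≡-Reasoning

  import Algebra.Solver.Ring as Solver
  open import Algebra.Solver.Ring.AlmostCommutativeRing
    using (fromCommutativeRing; Induced-equivalence; _-Raw-AlmostCommutative⟶_)

  private
    boolRing : RawRing _ _
    boolRing = record { Carrier = Bool ; _≈_ = _≡_ ; _+_ = _xor_ ; _*_ = _∧_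
                      ; -_ = id ; 0# = false ; 1# = true }

    +-homo : ∀ x y → [ x xor y ] ≡ [ x ] + [ y ]
    +-homo false y     = sym (+-identityˡ _)
    +-homo true  false = sym (+-identityʳ _)
    +-homo true  true  = sym (x+x≡0 _)

    *-homo : ∀ x y → [ x ∧ y ] ≡ [ x ] * [ y ]
    *-homo false y = sym (zeroˡ _)
    *-homo true  y = sym (*-identityˡ _)

    homo : boolRing -Raw-AlmostCommutative⟶ fromCommutativeRing commutativeRing
    homo = record { ⟦_⟧ = [_] ; +-homo = +-homo ; *-homo = *-homo
                  ; -‿homo = λ _ → refl ; 0-homo = refl ; 1-homo = refl }

    coeff≟ : WeaklyDecidable (Induced-equivalence homo)
    coeff≟ false false = just refl
    coeff≟ true  true  = just refl
    coeff≟ _     _     = nothing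

  open Solver boolRing (fromCommutativeRing commutativeRing) homo coeff≟ public
    using (solve; _:=_; _:+_; _:*_; con)

  open import Algebra.Properties.Semiring.Exp (CommutativeRing.semiring commutativeRing) public
    using (_^_; ^-homo-*)

  [xor] : ∀ x y → [ x xor y ] ≡ [ x ] + [ y ]
  [xor] = +-homo

  +≡0⇒≡ : ∀ {x y} → x + y ≡ 0# → x ≡ y
  +≡0⇒≡ {x} {y} p = begin
    x           ≡⟨ solve 2 (λ x y → x := (x :+ y) :+ y) refl x y ⟩
    (x + y) + y ≡⟨ cong (_+ y) p ⟩
    0# + y      ≡⟨ +-identityˡ y ⟩
    y           ∎

  ≡⇒+≡0 : ∀ {x y} → x ≡ y → x + y ≡ 0#
  ≡⇒+≡0 refl = x+x≡0 _

  *-zero-≡ : ∀ {x y} → y ≡ 0# → x * y ≡ 0#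
  *-zero-≡ refl = zeroʳ _

  -- Frobenius maps and polynomial functions

  frob : ℕ → A → A
  frob zero    x = x
  frob (suc k) x = frob k x * frob k x

  frob-+ : ∀ k x y → frob k (x + y) ≡ frob k x + frob k y
  frob-+ zero    x y = refl
  frob-+ (suc k) x y rewrite frob-+ k x y =
    solve 2 (λ u v → (u :+ v) :* (u :+ v) := u :* u :+ v :* v) refl (frob k x) (frob k y)

  frob-* : ∀ k x y → frob k (x * y) ≡ frob k x * frob k y
  frob-* zero    x y = refl
  frob-* (suc k) x y rewrite frob-* k x y =
    solve 2 (λ u v → (u :* v) :* (u :* v) := (u :* u) :* (v :* v)) refl (frob k x) (frob k y)

  frob-idem : ∀ k {x} → x * x ≡ x → frob k x ≡ x
  frob-idem zero    p = refl
  frob-idem (suc k) p rewrite frob-idem k p = p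

  frob-[] : ∀ k b → frob k [ b ] ≡ [ b ]
  frob-[] k false = frob-idem k (zeroˡ 0#)
  frob-[] k true  = frob-idem k (*-identityˡ 1#)

  frob-∘ : ∀ i j x → frob (i ℕ.+ j) x ≡ frob i (frob j x)
  frob-∘ zero    j x = refl
  frob-∘ (suc i) j x rewrite frob-∘ i j x = refl

  frob-^ : ∀ k x → frob k x ≡ x ^ (2 ℕ.^ k)
  frob-^ zero    x = sym (*-identityʳ x)
  frob-^ (suc k) x = begin
    frob k x * frob k x                   ≡⟨ cong₂ _*_ (frob-^ k x) (frob-^ k x) ⟩
    x ^ (2 ℕ.^ k) * x ^ (2 ℕ.^ k)         ≡⟨ sym (^-homo-* x (2 ℕ.^ k) (2 ℕ.^ k)) ⟩
    x ^ (2 ℕ.^ k ℕ.+ 2 ℕ.^ k)             ≡⟨ cong (λ n → x ^ (2 ℕ.^ k ℕ.+ n)) (sym (ℕₚ.+-identityʳ _)) ⟩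
    x ^ (2 ℕ.^ suc k)                     ∎

  -- f is a polynomial function of degree at most n whose coefficient of xⁿ is c,
  -- encoded by the fact that f x − f a is divisible by x − a.
  Pol : A → ℕ → (A → A) → Set
  Pol c zero    f = ∀ x → f x ≡ c
  Pol c (suc n) f = ∀ a → ∃ λ g → Pol c n g × (∀ x → f x + f a ≡ (x + a) * g x)

  Pol-+ : ∀ {c d f g} n → Pol c n f → Pol d n g → Pol (c + d) n (λ x → f x + g x)
  Pol-+ zero    p q x = cong₂ _+_ (p x) (q x)
  Pol-+ {f = f} {g} (suc n) p q a with p a | q a
  ... | f′ , pf , ef | g′ , pg , eg = _ , Pol-+ n pf pg , λ x → begin
    f x + g x + (f a + g a)
      ≡⟨ solve 4 (λ u v w t → (u :+ v) :+ (w :+ t) := (u :+ w) :+ (v :+ t)) refl (f x) (g x) (f a) (g a) ⟩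
    (f x + f a) + (g x + g a)
      ≡⟨ cong₂ _+_ (ef x) (eg x) ⟩
    (x + a) * f′ x + (x + a) * g′ x
      ≡⟨ sym (distribˡ _ _ _) ⟩
    (x + a) * (f′ x + g′ x) ∎

  Pol-scale : ∀ {c f} k n → Pol c n f → Pol (k * c) n (λ x → k * f x)
  Pol-scale k zero    p x = cong (k *_) (p x)
  Pol-scale {f = f} k (suc n) p a with p a
  ... | f′ , pf , ef = _ , Pol-scale k n pf , λ x → begin
    k * f x + k * f a      ≡⟨ sym (distribˡ _ _ _) ⟩
    k * (f x + f a)        ≡⟨ cong (k *_) (ef x) ⟩
    k * ((x + a) * f′ x)   ≡⟨ solve 3 (λ k s t → k :* (s :* t) := s :* (k :* t)) refl k (x + a) (f′ x) ⟩
    (x + a) * (k * f′ x)   ∎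

  Pol-suc : ∀ {c f} n → Pol c n f → Pol 0# (suc n) f
  Pol-suc {c} {f} zero p a = (λ _ → 0#) , (λ _ → refl) ,
    λ x → trans (≡⇒+≡0 (trans (p x) (sym (p a)))) (sym (zeroʳ _))
  Pol-suc (suc n) p a with p a
  ... | f′ , pf , ef = f′ , Pol-suc n pf , ef

  Pol-< : ∀ {c f} {m n} → m ℕ.< n → Pol c m f → Pol 0# n f
  Pol-< {m = m} {n} m<n p with ℕₚ.m≤n⇒m<n∨m≡n m<n
  ... | inj₂ refl = Pol-suc m p
  Pol-< {n = suc n} m<n p | inj₁ (s≤s m<n′) = Pol-suc n (Pol-< m<n′ p)

  Pol-+< : ∀ {c d f g} {m n} → m ℕ.< n → Pol d m g → Pol c n f → Pol c n (λ x → f x + g x)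
  Pol-+< {c} {n = n} m<n q p = subst (λ c → Pol c n _) (+-identityʳ c) (Pol-+ n p (Pol-< m<n q))

  -- The identity `x f(x) − a f(a) = (x − a) f(x) + a (f(x) − f(a))` gives the quotient `f + a
  -- f′`, where `f′` is the quotient of `f` at `a`. The term `a
  -- f′` has lower degree than `f`, so the leading coefficient stays `c`.
  Pol-x* : ∀ {c f} n → Pol c n f → Pol c (suc n) (λ x → x * f x)
  Pol-x* {c} {f} zero p a = f , p , λ x → begin
    x * f x + a * f a ≡⟨ cong (λ z → x * f x + a * z) (trans (p a) (sym (p x))) ⟩
    x * f x + a * f x ≡⟨ sym (distribʳ _ _ _) ⟩
    (x + a) * f x     ∎
  Pol-x* {c} {f} (suc n) p a with p a
  ... | f′ , pf , ef = _ , Pol-+< ℕₚ.≤-refl (Pol-scale a n pf) p , λ x → begin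
    x * f x + a * f a
      ≡⟨ solve 4 (λ x a u v → x :* u :+ a :* v := (x :+ a) :* u :+ a :* (u :+ v)) refl x a (f x) (f a) ⟩
    (x + a) * f x + a * (f x + f a)
      ≡⟨ cong (λ z → (x + a) * f x + a * z) (ef x) ⟩
    (x + a) * f x + a * ((x + a) * f′ x)
      ≡⟨ solve 4 (λ x a u v → (x :+ a) :* u :+ a :* ((x :+ a) :* v) := (x :+ a) :* (u :+ a :* v)) refl x a (f x) (f′ x) ⟩
    (x + a) * (f x + a * f′ x) ∎

  Pol-ext : ∀ {c f g} n → (∀ x → f x ≡ g x) → Pol c n f → Pol c n g
  Pol-ext zero    eq p x = trans (sym (eq x)) (p x)
  Pol-ext (suc n) eq p a with p a
  ... | f′ , pf , ef = f′ , pf , λ x → trans (sym (cong₂ _+_ (eq x) (eq a))) (ef x)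

  Pol-^ : ∀ n → Pol 1# n (_^ n)
  Pol-^ zero    x = refl
  Pol-^ (suc n) = Pol-x* n (Pol-^ n)

  Pol-frob : ∀ k → Pol 1# (2 ℕ.^ k) (frob k)
  Pol-frob k = Pol-ext (2 ℕ.^ k) (λ x → sym (frob-^ k x)) (Pol-^ (2 ℕ.^ k))

  -- Polynomials over 𝔽₂ and the bound on the number of roots

  eval : ∀ {k} → Vec Bool k → A → A
  eval []      x = 0#
  eval (b ∷ p) x = [ b ] + x * eval p x

  -- Frobenius is a ring endomorphism that fixes the coefficients 0 and 1. Hence the conjugates of a
  -- root are again roots.
  eval-frob : ∀ k {l} (p : Vec Bool l) x → eval p (frob k x) ≡ frob k (eval p x)
  eval-frob k []      x = sym (frob-[] k false)
  eval-frob k (b ∷ p) x = begin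
    [ b ] + frob k x * eval p (frob k x)     ≡⟨ cong₂ (λ u v → u + frob k x * v) (sym (frob-[] k b)) (eval-frob k p x) ⟩
    frob k [ b ] + frob k x * frob k (eval p x) ≡⟨ cong (frob k [ b ] +_) (sym (frob-* k _ _)) ⟩
    frob k [ b ] + frob k (x * eval p x)     ≡⟨ sym (frob-+ k _ _) ⟩
    frob k ([ b ] + x * eval p x)            ∎

  eval-xor : ∀ {k} (p q : Vec Bool k) x → eval (Vec.zipWith _xor_ p q) x ≡ eval p x + eval q x
  eval-xor []      []      x = sym (+-identityˡ 0#)
  eval-xor (a ∷ p) (b ∷ q) x = begin
    [ a xor b ] + x * eval (Vec.zipWith _xor_ p q) x
      ≡⟨ cong₂ (λ u v → u + x * v) ([xor] a b) (eval-xor p q x) ⟩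
    [ a ] + [ b ] + x * (eval p x + eval q x)
      ≡⟨ solve 5 (λ a b x u v → a :+ b :+ x :* (u :+ v) := (a :+ x :* u) :+ (b :+ x :* v)) refl
           [ a ] [ b ] x (eval p x) (eval q x) ⟩
    ([ a ] + x * eval p x) + ([ b ] + x * eval q x) ∎

  eval-0 : ∀ k x → eval (Vec.replicate k false) x ≡ 0#
  eval-0 zero    x = refl
  eval-0 (suc k) x = trans (+-identityˡ _) (*-zero-≡ (eval-0 k x))

  -- Over 𝔽₂ the highest nonzero coefficient can only be 1, so every nonzero polynomial is monic.
  eval-Pol : ∀ {k} (p : Vec Bool k) → p ≡ Vec.replicate k false ⊎ ∃ λ n → n ℕ.< k × Pol 1# n (eval p)
  eval-Pol []      = inj₁ refl
  eval-Pol (b ∷ p) with eval-Pol p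
  ... | inj₂ (n , n<k , P) = inj₂ (suc n , s≤s n<k ,
    Pol-ext (suc n) (λ x → +-comm _ _) (Pol-+< {d = [ b ]} (s≤s z≤n) (λ _ → refl) (Pol-x* n P)))
  eval-Pol (false ∷ p) | inj₁ refl = inj₁ refl
  eval-Pol {suc k} (true ∷ p) | inj₁ refl = inj₂ (0 , s≤s z≤n , λ x →
    trans (cong (1# +_) (*-zero-≡ (eval-0 k x))) (+-identityʳ 1#))

  module _ (e : A) (prime : ∀ u v → e * (u * v) ≡ 0# → e * u ≡ 0# ⊎ e * v ≡ 0#) where

    -- Everything is read modulo the annihilator of `e`, and `prime` says that the quotient has no
    -- zero divisors. Dividing by `x − a₀` lowers the degree, keeps the leading coefficient, and
    -- keeps the other roots because they differ from `a₀`. What remains at the end is the constant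
    -- `c`, which has a root.
    root-bound : ∀ {c f} n → Pol c n f → (a : Fin (suc n) → A) →
                 (∀ i j → e * (a i + a j) ≡ 0# → i ≡ j) →
                 (∀ i → e * f (a i) ≡ 0#) → e * c ≡ 0#
    root-bound zero P a inj root = trans (cong (e *_) (sym (P (a zero)))) (root zero)
    root-bound {f = f} (suc n) P a inj root with P (a zero)
    ... | g , Pg , eg = root-bound n Pg (a ∘ suc) inj′ root′
      where
      inj′ : ∀ i j → e * (a (suc i) + a (suc j)) ≡ 0# → i ≡ j
      inj′ i j p with inj (suc i) (suc j) p
      ... | refl = refl
      root′ : ∀ i → e * g (a (suc i)) ≡ 0#
      root′ i with prime (a (suc i) + a zero) (g (a (suc i))) (begin
        e * ((a (suc i) + a zero) * g (a (suc i))) ≡⟨ cong (e *_) (sym (eg _)) ⟩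
        e * (f (a (suc i)) + f (a zero))           ≡⟨ distribˡ _ _ _ ⟩
        e * f (a (suc i)) + e * f (a zero)         ≡⟨ cong₂ _+_ (root _) (root _) ⟩
        0# + 0#                                    ≡⟨ +-identityˡ _ ⟩
        0#                                         ∎)
      ... | inj₂ q = q
      ... | inj₁ q with inj (suc i) zero q
      ...   | ()

  -- Von Neumann regularity and primitive idempotents

  module Regular (m : ℕ) (frob-fix : ∀ x → frob (suc m) x ≡ x) where

    private
      -- The power `x^(2^k − 1)`, built without subtraction from `2^(k+1) − 1 = 1 + 2 (2^k − 1)`.
      w : ℕ → A → A
      w zero    x = 1#
      w (suc k) x = x * (w k x * w k x)

      x*w : ∀ k x → x * w k x ≡ frob k x
      x*w zero    x = *-identityʳ x
      x*w (suc k) x = begin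
        x * (x * (w k x * w k x))   ≡⟨ solve 2 (λ x w → x :* (x :* (w :* w)) := (x :* w) :* (x :* w)) refl x (w k x) ⟩
        (x * w k x) * (x * w k x)   ≡⟨ cong₂ _*_ (x*w k x) (x*w k x) ⟩
        frob (suc k) x              ∎

    -- The power `x^(2^(m+1) − 2)`, a quasi-inverse of `x`. It makes `x * ρ x` an idempotent that
    -- generates the same ideal as `x`.
    ρ : A → A
    ρ x = w m x * w m x

    x*x*ρ : ∀ x → x * (x * ρ x) ≡ x
    x*x*ρ x = trans (x*w (suc m) x) (frob-fix x)

    x*ρ-idem : ∀ x → (x * ρ x) * (x * ρ x) ≡ x * ρ x
    x*ρ-idem x = begin
      (x * ρ x) * (x * ρ x)   ≡⟨ solve 2 (λ x w → (x :* w) :* (x :* w) := (x :* (x :* w)) :* w) refl x (ρ x) ⟩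
      (x * (x * ρ x)) * ρ x   ≡⟨ cong (_* ρ x) (x*x*ρ x) ⟩
      x * ρ x                 ∎

    sq≡0⇒≡0 : ∀ {x} → x * x ≡ 0# → x ≡ 0#
    sq≡0⇒≡0 {x} p = begin
      x               ≡⟨ sym (x*x*ρ x) ⟩
      x * (x * ρ x)   ≡⟨ sym (*-assoc _ _ _) ⟩
      (x * x) * ρ x   ≡⟨ cong (_* ρ x) p ⟩
      0# * ρ x        ≡⟨ zeroˡ _ ⟩
      0#              ∎

    frob≡0⇒≡0 : ∀ k {x} → frob k x ≡ 0# → x ≡ 0#
    frob≡0⇒≡0 zero    p = p
    frob≡0⇒≡0 (suc k) p = frob≡0⇒≡0 k (sq≡0⇒≡0 p)

    -- Either alternative, once it holds for r, survives passing to an idempotent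
    -- below e; so one pass over a list of all elements yields a primitive idempotent.
    refine-idempotent : DecidableEquality A → ∀ rs e → e * e ≡ e → e ≢ 0# →
      ∃ λ e′ → e′ * e′ ≡ e′ × e′ ≢ 0# × e′ * e ≡ e′ ×
               All (λ r → e′ * r ≡ 0# ⊎ e′ * (r * ρ r) ≡ e′) rs
    refine-idempotent _≟_ []       e ee e≢0 = e , ee , e≢0 , ee , []
    refine-idempotent _≟_ (r ∷ rs) e ee e≢0 with (e * r) ≟ 0#
    ... | yes er≡0 with refine-idempotent _≟_ rs e ee e≢0
    ...   | e′ , e′e′ , e′≢0 , e′e , all = e′ , e′e′ , e′≢0 , e′e , inj₁ (begin
      e′ * r        ≡⟨ cong (_* r) (sym e′e) ⟩
      (e′ * e) * r  ≡⟨ *-assoc _ _ _ ⟩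
      e′ * (e * r)  ≡⟨ *-zero-≡ er≡0 ⟩
      0#            ∎) ∷ all
    refine-idempotent _≟_ (r ∷ rs) e ee e≢0 | no er≢0
      with refine-idempotent _≟_ rs (e * (r * ρ r)) idem nonzero
      where
      u = r * ρ r
      idem : e * u * (e * u) ≡ e * u
      idem = begin
        e * u * (e * u)    ≡⟨ solve 2 (λ e u → e :* u :* (e :* u) := (e :* e) :* (u :* u)) refl e u ⟩
        (e * e) * (u * u)  ≡⟨ cong₂ _*_ ee (x*ρ-idem r) ⟩
        e * u              ∎
      nonzero : e * u ≢ 0#
      nonzero p = er≢0 (begin
        e * r              ≡⟨ cong (e *_) (sym (x*x*ρ r)) ⟩
        e * (r * u)        ≡⟨ solve 3 (λ e r u → e :* (r :* u) := r :* (e :* u)) refl e r u ⟩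
        r * (e * u)        ≡⟨ *-zero-≡ p ⟩
        0#                 ∎)
    ... | e′ , e′e′ , e′≢0 , e′eu , all = e′ , e′e′ , e′≢0 , below e ee′ , inj₂ (below u uu′) ∷ all
      where
      u = r * ρ r
      below : ∀ v → (e * u) * v ≡ e * u → e′ * v ≡ e′
      below v p = begin
        e′ * v              ≡⟨ cong (_* v) (sym e′eu) ⟩
        (e′ * (e * u)) * v  ≡⟨ *-assoc _ _ _ ⟩
        e′ * ((e * u) * v)  ≡⟨ cong (e′ *_) p ⟩
        e′ * (e * u)        ≡⟨ e′eu ⟩
        e′                  ∎
      ee′ : (e * u) * e ≡ e * u
      ee′ = trans (solve 2 (λ e u → (e :* u) :* e := (e :* e) :* u) refl e u) (cong (_* u) ee)
      uu′ : (e * u) * u ≡ e * u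
      uu′ = trans (*-assoc _ _ _) (cong (e *_) (x*ρ-idem r))

    -- If `u` is not killed by `e`, then `ρ u` inverts it below `e`, and multiplying `e u v = 0` by
    -- `ρ u` leaves `e v = 0`.
    primitive⇒prime : ∀ {e} → (∀ r → e * r ≡ 0# ⊎ e * (r * ρ r) ≡ e) →
                      ∀ u v → e * (u * v) ≡ 0# → e * u ≡ 0# ⊎ e * v ≡ 0#
    primitive⇒prime {e} prim u v p with prim u
    ... | inj₁ q = inj₁ q
    ... | inj₂ q = inj₂ (begin
      e * v                   ≡⟨ cong (_* v) (sym q) ⟩
      e * (u * ρ u) * v       ≡⟨ solve 4 (λ e u w v → e :* (u :* w) :* v := w :* (e :* (u :* v))) refl e u (ρ u) v ⟩
      ρ u * (e * (u * v))     ≡⟨ *-zero-≡ p ⟩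
      0#                      ∎)

-- The cyclic algebra over 𝔽₂

infixl 6 _⊕_
_⊕_ : ∀ {n} → Vec Bool n → Vec Bool n → Vec Bool n
_⊕_ = zipWith _xor_

𝟘 : ∀ {n} → Vec Bool n
𝟘 = replicate _ false

⊕-same : ∀ {n} (v : Vec Bool n) → v ⊕ v ≡ 𝟘
⊕-same []      = refl
⊕-same (b ∷ v) = cong₂ _∷_ (𝔹ₚ.xor-same b) (⊕-same v)

⊕-isAbelianGroup : ∀ {n} → IsAbelianGroup _≡_ (_⊕_ {n}) 𝟘 id
⊕-isAbelianGroup = record
  { isGroup = record
    { isMonoid = record
      { isSemigroup = record
        { isMagma = record { isEquivalence = isEquivalence ; ∙-cong = cong₂ _⊕_ }
        ; assoc   = Vecₚ.zipWith-assoc 𝔹ₚ.xor-assoc }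
      ; identity = Vecₚ.zipWith-identityˡ 𝔹ₚ.xor-identityˡ , Vecₚ.zipWith-identityʳ 𝔹ₚ.xor-identityʳ }
    ; inverse = ⊕-same , ⊕-same
    ; ⁻¹-cong = id }
  ; comm = Vecₚ.zipWith-comm 𝔹ₚ.xor-comm }

module ⊕ {n} = IsAbelianGroup (⊕-isAbelianGroup {n})

⊕-commutativeSemigroup : ℕ → CommutativeSemigroup _ _
⊕-commutativeSemigroup n =
  record { isCommutativeSemigroup = record { isSemigroup = ⊕.isSemigroup {n} ; comm = ⊕.comm } }

⊕-interchange : ∀ {n} (a b c d : Vec Bool n) → (a ⊕ b) ⊕ (c ⊕ d) ≡ (a ⊕ c) ⊕ (b ⊕ d)
⊕-interchange {n} = interchange
  where open import Algebra.Properties.CommutativeSemigroup (⊕-commutativeSemigroup n) using (interchange)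

-- Coefficient vectors: padding, truncation and shifting

pad : ∀ {k} → Vec Bool k → ∀ n → Vec Bool n
pad []      n       = 𝟘
pad (b ∷ p) zero    = []
pad (b ∷ p) (suc n) = b ∷ pad p n

pad-full : ∀ {n} (p : Vec Bool n) → pad p n ≡ p
pad-full []      = refl
pad-full (b ∷ p) = cong (b ∷_) (pad-full p)

shift : ∀ {n} → Bool → Vec Bool n → Vec Bool n
shift c []      = []
shift c (b ∷ v) = c ∷ shift b v

-- The coefficient that `shift c v` pushes out at the top. When `v` is empty this is the incoming
-- `c` itself.
last : ∀ {n} → Bool → Vec Bool n → Bool
last c []      = c
last c (b ∷ v) = last b v

shift-⊕ : ∀ {n} c d (v w : Vec Bool n) → shift (c xor d) (v ⊕ w) ≡ shift c v ⊕ shift d w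
shift-⊕ c d []      []      = refl
shift-⊕ c d (a ∷ v) (b ∷ w) = cong (_ ∷_) (shift-⊕ a b v w)

last-⊕ : ∀ {n} c d (v w : Vec Bool n) → last (c xor d) (v ⊕ w) ≡ last c v xor last d w
last-⊕ c d []      []      = refl
last-⊕ c d (a ∷ v) (b ∷ w) = last-⊕ a b v w

shift-𝟘 : ∀ n → shift false (𝟘 {n}) ≡ 𝟘
shift-𝟘 zero    = refl
shift-𝟘 (suc n) = cong (false ∷_) (shift-𝟘 n)

shift-pad : ∀ {k} c (p : Vec Bool k) n → shift c (pad p n) ≡ pad (c ∷ p) n
shift-pad c []      zero    = refl
shift-pad c []      (suc n) = cong (c ∷_) (shift-𝟘 n)
shift-pad c (b ∷ p) zero    = refl
shift-pad c (b ∷ p) (suc n) = cong (c ∷_) (shift-pad b p n)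

last-pad : ∀ {k n} c (p : Vec Bool k) → k ℕ.< n → last c (pad p n) ≡ false
last-pad {n = suc zero}    c []      k<n       = refl
last-pad {n = suc (suc n)} c []      k<n       = last-pad {n = suc n} false [] (s≤s z≤n)
last-pad {n = suc n}       c (b ∷ p) (s≤s k<n) = last-pad b p k<n

monomial : ∀ j → Vec Bool (suc j)
monomial zero    = true ∷ []
monomial (suc j) = false ∷ monomial j

last-monomial : ∀ c j → last c (pad (monomial j) (suc j)) ≡ true
last-monomial c zero    = refl
last-monomial c (suc j) = last-monomial false j

-- `pad` also truncates: at length `j` the only nonzero coefficient, in degree `j`, is cut off. In
-- `x^N` this leaves just the bit that wrapped around to degree 0.
pad-monomial : ∀ j → pad (monomial j) j ≡ 𝟘
pad-monomial zero    = refl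
pad-monomial (suc j) = cong (false ∷_) (pad-monomial j)

-- 𝔽₂[x]/(x^(M+1) − 1) on coefficient vectors: multiplication by x is the cyclic
-- shift, and v * w applies v as a polynomial in the shift to w.
module Cyclic (M : ℕ) where

  V : Set
  V = Vec Bool (suc M)

  rotate : V → V
  rotate v = shift (last false v) v

  rotate-⊕ : ∀ v w → rotate (v ⊕ w) ≡ rotate v ⊕ rotate w
  rotate-⊕ v w = trans (cong (λ c → shift c (v ⊕ w)) (last-⊕ false false v w)) (shift-⊕ _ _ v w)

  rotate-pad : ∀ {k} (p : Vec Bool k) → k ℕ.< suc M → rotate (pad p (suc M)) ≡ pad (false ∷ p) (suc M)
  rotate-pad p k<N rewrite last-pad false p k<N = shift-pad false p (suc M)

  rotate-𝟘 : rotate 𝟘 ≡ 𝟘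
  rotate-𝟘 = rotate-pad [] (s≤s z≤n)

  _▹_ : Bool → V → V
  b ▹ v = if b then v else 𝟘

  ▹-⊕ : ∀ b v w → b ▹ (v ⊕ w) ≡ (b ▹ v) ⊕ (b ▹ w)
  ▹-⊕ false v w = sym (⊕.identityˡ 𝟘)
  ▹-⊕ true  v w = refl

  ▹-rotate : ∀ b v → b ▹ rotate v ≡ rotate (b ▹ v)
  ▹-rotate false v = sym rotate-𝟘
  ▹-rotate true  v = refl

  act : ∀ {k} → Vec Bool k → V → V
  act []      v = 𝟘
  act (b ∷ p) v = (b ▹ v) ⊕ rotate (act p v)

  act-⊕ : ∀ {k} (p : Vec Bool k) v w → act p (v ⊕ w) ≡ act p v ⊕ act p w
  act-⊕ []      v w = sym (⊕.identityˡ 𝟘)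
  act-⊕ (b ∷ p) v w
    rewrite ▹-⊕ b v w | act-⊕ p v w | rotate-⊕ (act p v) (act p w) =
    ⊕-interchange (b ▹ v) (b ▹ w) _ _

  act-rotate : ∀ {k} (p : Vec Bool k) v → act p (rotate v) ≡ rotate (act p v)
  act-rotate []      v = sym rotate-𝟘
  act-rotate (b ∷ p) v
    rewrite ▹-rotate b v | act-rotate p v = sym (rotate-⊕ (b ▹ v) _)

  act-𝟘 : ∀ {k} (p : Vec Bool k) → act p 𝟘 ≡ 𝟘
  act-𝟘 []      = refl
  act-𝟘 (b ∷ p) =
    trans (cong₂ _⊕_ (▹-𝟘 b) (trans (cong rotate (act-𝟘 p)) rotate-𝟘)) (⊕.identityˡ 𝟘)
    where
    ▹-𝟘 : ∀ b → b ▹ 𝟘 ≡ 𝟘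
    ▹-𝟘 false = refl
    ▹-𝟘 true  = refl

  act-▹ : ∀ {k} (p : Vec Bool k) b v → act p (b ▹ v) ≡ b ▹ act p v
  act-▹ p false v = act-𝟘 p
  act-▹ p true  v = refl

  act-act : ∀ {k l} (p : Vec Bool k) (q : Vec Bool l) v → act p (act q v) ≡ act q (act p v)
  act-act p []      v = act-𝟘 p
  act-act p (b ∷ q) v
    rewrite act-⊕ p (b ▹ v) (rotate (act q v)) | act-▹ p b v
          | act-rotate p (act q v) | act-act p q v = refl

  δ : V
  δ = pad (true ∷ []) (suc M)

  -- Up to length `suc M` no coefficient wraps around, so Horner's scheme applied to the unit vector
  -- writes out the coefficients of `p`.
  act-δ : ∀ {k} (p : Vec Bool k) → k ℕ.≤ suc M → act p δ ≡ pad p (suc M)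
  act-δ []      k≤N = refl
  act-δ (b ∷ p) k≤N
    rewrite act-δ p (ℕₚ.<⇒≤ k≤N) | rotate-pad p k≤N = lemma b
    where
    lemma : ∀ b → (b ▹ δ) ⊕ (false ∷ pad p M) ≡ b ∷ pad p M
    lemma false = ⊕.identityˡ _
    lemma true  = cong (true ∷_) (⊕.identityˡ _)

  act-δ-self : ∀ v → act v δ ≡ v
  act-δ-self v = trans (act-δ v ℕₚ.≤-refl) (pad-full v)

  -- `δ` is a cyclic vector: each `w` is `act w δ`. Since polynomials in the one operator `rotate`
  -- commute with each other, the product does too.
  act-comm : ∀ v w → act v w ≡ act w v
  act-comm v w = begin
    act v w             ≡⟨ cong (act v) (sym (act-δ-self w)) ⟩
    act v (act w δ)     ≡⟨ act-act v w δ ⟩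
    act w (act v δ)     ≡⟨ cong (act w) (act-δ-self v) ⟩
    act w v             ∎
    where open ≡-Reasoning

  ring : Char2Ring V
  ring = record
    { _+_ = _⊕_ ; _*_ = act ; 0# = 𝟘 ; 1# = δ
    ; isCommutativeRing = record
      { isRing = record
        { +-isAbelianGroup = ⊕-isAbelianGroup
        ; *-cong     = cong₂ act
        ; *-assoc    = λ u v w → begin
            act (act u v) w   ≡⟨ act-comm (act u v) w ⟩
            act w (act u v)   ≡⟨ act-act w u v ⟩
            act u (act w v)   ≡⟨ cong (act u) (act-comm w v) ⟩
            act u (act v w)   ∎
        ; *-identity = (λ v → trans (act-comm δ v) (act-δ-self v)) , act-δ-self
        ; distrib    = act-⊕ , λ u v w → begin
            act (v ⊕ w) u          ≡⟨ act-comm (v ⊕ w) u ⟩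
            act u (v ⊕ w)          ≡⟨ act-⊕ u v w ⟩
            act u v ⊕ act u w      ≡⟨ cong₂ _⊕_ (act-comm u v) (act-comm u w) ⟩
            act v u ⊕ act w u      ∎ }
      ; *-comm = act-comm } }
    where open ≡-Reasoning

  open Char2 ring
  open ≡-Reasoning

  x : V
  x = rotate δ

  x*v : ∀ v → x * v ≡ rotate v
  x*v v = begin
    act x v          ≡⟨ act-comm x v ⟩
    act v (rotate δ) ≡⟨ act-rotate v δ ⟩
    rotate (act v δ) ≡⟨ cong rotate (act-δ-self v) ⟩
    rotate v         ∎

  eval-act : ∀ {k} (p : Vec Bool k) → eval p x ≡ act p δ
  eval-act []      = refl
  eval-act (b ∷ p) = cong₂ _⊕_ (b-δ b) (trans (x*v _) (cong rotate (eval-act p)))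
    where
    b-δ : ∀ b → [ b ] ≡ b ▹ δ
    b-δ false = refl
    b-δ true  = refl

  eval-self : ∀ v → eval v x ≡ v
  eval-self v = trans (eval-act v) (act-δ-self v)

  x^ : ∀ j → j ℕ.≤ M → x ^ j ≡ pad (monomial j) (suc M)
  x^ zero    j≤M = refl
  x^ (suc j) j<M = begin
    x * x ^ j                           ≡⟨ x*v _ ⟩
    rotate (x ^ j)                      ≡⟨ cong rotate (x^ j (ℕₚ.<⇒≤ j<M)) ⟩
    rotate (pad (monomial j) (suc M))   ≡⟨ rotate-pad (monomial j) (s≤s j<M) ⟩
    pad (monomial (suc j)) (suc M)      ∎

  last-x^M : last false (x ^ M) ≡ true
  last-x^M = trans (cong (last false) (x^ M ℕₚ.≤-refl)) (last-monomial false M)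

  x^N : x ^ suc M ≡ 1#
  x^N = begin
    x * x ^ M                                ≡⟨ x*v _ ⟩
    shift (last false (x ^ M)) (x ^ M)       ≡⟨ cong₂ shift last-x^M (x^ M ℕₚ.≤-refl) ⟩
    shift true (pad (monomial M) (suc M))    ≡⟨ shift-pad true (monomial M) (suc M) ⟩
    true ∷ pad (monomial M) M                ≡⟨ cong (true ∷_) (pad-monomial M) ⟩
    δ                                        ∎

  last-eval : ∀ (p : Vec Bool M) → last false (eval p x) ≡ false
  last-eval p = begin
    last false (eval p x)         ≡⟨ cong (last false) (eval-act p) ⟩
    last false (act p δ)          ≡⟨ cong (last false) (act-δ p (ℕₚ.n≤1+n M)) ⟩
    last false (pad p (suc M))    ≡⟨ last-pad false p ℕₚ.≤-refl ⟩
    false                         ∎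

  -- The coefficient of `x^M`, which `last false` reads off, is 1: the polynomial `p` has degree
  -- below `M` and contributes nothing there.
  eval+x^M≢0 : ∀ (p : Vec Bool M) → eval p x + x ^ M ≢ 0#
  eval+x^M≢0 p eq with begin
      true                                             ≡⟨ sym (cong₂ _xor_ (last-eval p) last-x^M) ⟩
      last false (eval p x) xor last false (x ^ M)     ≡⟨ sym (last-⊕ false false (eval p x) (x ^ M)) ⟩
      last false (eval p x + x ^ M)                    ≡⟨ cong (last false) eq ⟩
      last false (pad [] (suc M))                      ≡⟨ last-pad {n = suc M} false [] (s≤s z≤n) ⟩
      false ∎
  ... | ()

  -- Every element is a polynomial in `x` over 𝔽₂, so by `eval-frob` it suffices to treat `x`, where
  -- `x^(M+2) = x · x^(M+1) = x`.
  frob-fix : ∀ k → 2 ℕ.^ k ≡ 2 ℕ.+ M → ∀ v → frob k v ≡ v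
  frob-fix k eq v = trans (cong (frob k) (sym (eval-self v)))
    (trans (sym (eval-frob k v x)) (trans (cong (eval v) x-fix) (eval-self v)))
    where
    x-fix : frob k x ≡ x
    x-fix = begin
      frob k x       ≡⟨ frob-^ k x ⟩
      x ^ (2 ℕ.^ k)  ≡⟨ cong (x ^_) eq ⟩
      x * x ^ suc M  ≡⟨ cong (x *_) x^N ⟩
      x * 1#         ≡⟨ *-identityʳ x ⟩
      x              ∎

-- Degrees in `x` and the separating element

degree : ℕ → ℕ
degree zero    = 0
degree (suc k) = 2 ℕ.^ suc k ℕ.+ degree k

-- The geometric sum `2 + 4 + ⋯ + 2^k`, which is the degree of `∏ (X^(2^d) − X)` over `1 ≤ d ≤ k`.
-- Adding 2 avoids subtraction.
2+degree : ∀ k → 2 ℕ.+ degree k ≡ 2 ℕ.^ suc k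
2+degree zero    = refl
2+degree (suc k) = begin
  2 ℕ.+ (2 ℕ.^ suc k ℕ.+ degree k)  ≡⟨ sym (ℕₚ.+-assoc 2 (2 ℕ.^ suc k) (degree k)) ⟩
  2 ℕ.+ 2 ℕ.^ suc k ℕ.+ degree k    ≡⟨ cong (ℕ._+ degree k) (ℕₚ.+-comm 2 (2 ℕ.^ suc k)) ⟩
  2 ℕ.^ suc k ℕ.+ 2 ℕ.+ degree k    ≡⟨ ℕₚ.+-assoc (2 ℕ.^ suc k) 2 (degree k) ⟩
  2 ℕ.^ suc k ℕ.+ (2 ℕ.+ degree k)  ≡⟨ cong (2 ℕ.^ suc k ℕ.+_) (trans (2+degree k) (sym (ℕₚ.+-identityʳ _))) ⟩
  2 ℕ.^ suc (suc k) ∎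
  where open ≡-Reasoning

module Degree {A : Set} (R : Char2Ring A) (x : A) where
  open Char2 R
  open ≡-Reasoning

  -- Degree below `n`, and degree `n` with leading coefficient 1. Both assert only that some
  -- expression of `r` as a polynomial in `x` has this shape; relations satisfied by `x` may allow
  -- others.
  Low Monic : ℕ → A → Set
  Low n r   = ∃ λ (p : Vec Bool n) → r ≡ eval p x
  Monic n r = ∃ λ q → Low n q × r ≡ q + x ^ n

  eval-pad : ∀ {k n} (p : Vec Bool k) → k ℕ.≤ n → eval (pad p n) x ≡ eval p x
  eval-pad {n = n} [] k≤n = eval-0 n x
  eval-pad (b ∷ p) (s≤s k≤n) = cong (λ z → [ b ] + x * z) (eval-pad p k≤n)

  Low-≤ : ∀ {k n r} → k ℕ.≤ n → Low k r → Low n r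
  Low-≤ {n = n} k≤n (p , eq) = pad p n , trans eq (sym (eval-pad p k≤n))

  Low-0 : ∀ n → Low n 0#
  Low-0 n = 𝟘 , sym (eval-0 n x)

  Low-+ : ∀ {n r s} → Low n r → Low n s → Low n (r + s)
  Low-+ (p , eq) (q , eq′) = p ⊕ q , trans (cong₂ _+_ eq eq′) (sym (eval-xor p q x))

  Low-x* : ∀ {n r} → Low n r → Low (suc n) (x * r)
  Low-x* (p , refl) = false ∷ p , sym (+-identityˡ _)

  Low-x^ : ∀ n → Low (suc n) (x ^ n)
  Low-x^ zero    = true ∷ [] , sym (trans (cong (1# +_) (zeroʳ x)) (+-identityʳ 1#))
  Low-x^ (suc n) = Low-x* (Low-x^ n)

  Monic⇒Low : ∀ {n r} → Monic n r → Low (suc n) r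
  Monic⇒Low {n} (q , lq , refl) = Low-+ (Low-≤ (ℕₚ.n≤1+n n) lq) (Low-x^ n)

  Low+Monic : ∀ {n q r} → Low n q → Monic n r → Monic n (q + r)
  Low+Monic lq (q′ , lq′ , refl) = _ , Low-+ lq lq′ , sym (+-assoc _ _ _)

  Monic-x^* : ∀ n {k r} → Monic k r → Monic (n ℕ.+ k) (x ^ n * r)
  Monic-x^* zero    (q , lq , eq) = q , lq , trans (*-identityˡ _) eq
  Monic-x^* (suc n) {k} {r} mr with Monic-x^* n mr
  ... | q , lq , eq = x * q , Low-x* lq , (begin
    x * x ^ n * r          ≡⟨ *-assoc _ _ _ ⟩
    x * (x ^ n * r)        ≡⟨ cong (x *_) eq ⟩
    x * (q + x ^ (n ℕ.+ k)) ≡⟨ distribˡ _ _ _ ⟩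
    x * q + x * x ^ (n ℕ.+ k)      ∎)

  Low-*Monic : ∀ {n k s} (p : Vec Bool n) → Monic k s → Low (n ℕ.+ k) (eval p x * s)
  Low-*Monic {k = k} []      ms = subst (Low k) (sym (zeroˡ _)) (Low-0 k)
  Low-*Monic {suc n} {k} {s} (b ∷ p) ms =
    subst (Low _) (begin
      [ b ] * s + x * (eval p x * s)  ≡⟨ cong ([ b ] * s +_) (sym (*-assoc _ _ _)) ⟩
      [ b ] * s + x * eval p x * s    ≡⟨ sym (distribʳ _ _ _) ⟩
      ([ b ] + x * eval p x) * s      ∎)
    (Low-+ (Low-≤ (s≤s (ℕₚ.m≤n+m k n)) (const b)) (Low-x* (Low-*Monic p ms)))
    where
    const : ∀ b → Low (suc k) ([ b ] * s)
    const false = subst (Low _) (sym (zeroˡ s)) (Low-0 _)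
    const true  = subst (Low _) (sym (*-identityˡ s)) (Monic⇒Low ms)

  Monic-* : ∀ {n k r s} → Monic n r → Monic k s → Monic (n ℕ.+ k) (r * s)
  Monic-* {n} {s = s} (q , (p , refl) , refl) ms =
    subst (Monic _) (sym (distribʳ s _ _)) (Low+Monic (Low-*Monic p ms) (Monic-x^* n ms))

  Monic-frob : ∀ k → Monic (2 ℕ.^ suc k) (frob (suc k) x + x)
  Monic-frob k = x , Low-≤ 2≤ (subst (Low 2) (*-identityʳ x) (Low-x^ 1)) ,
    trans (+-comm _ x) (cong (x +_) (frob-^ (suc k) x))
    where
    2≤ : 2 ℕ.≤ 2 ℕ.^ suc k
    2≤ = ℕₚ.*-monoʳ-≤ 2 (ℕₚ.m^n>0 2 k)

  separator : ℕ → A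
  separator zero    = 1#
  separator (suc k) = (frob (suc k) x + x) * separator k

  Monic-separator : ∀ k → Monic (degree k) (separator k)
  Monic-separator zero    = 0# , ([] , refl) , sym (+-identityˡ _)
  Monic-separator (suc k) = Monic-* (Monic-frob k) (Monic-separator k)

  separator-factor : ∀ k d → d ℕ.< k → ∃ λ c → separator k ≡ (frob (suc d) x + x) * c
  separator-factor (suc k) d (s≤s d≤k) with ℕₚ.m≤n⇒m<n∨m≡n d≤k
  ... | inj₂ refl = separator k , refl
  ... | inj₁ d<k with separator-factor k d d<k
  ...   | c , eq = (frob (suc k) x + x) * c , (begin
    (frob (suc k) x + x) * separator k                   ≡⟨ cong ((frob (suc k) x + x) *_) eq ⟩
    (frob (suc k) x + x) * ((frob (suc d) x + x) * c)    ≡⟨ solve 3 (λ u v w → u :* (v :* w) := v :* (u :* w)) refl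
                                                              (frob (suc k) x + x) (frob (suc d) x + x) c ⟩
    (frob (suc d) x + x) * ((frob (suc k) x + x) * c)    ∎)

-- Existence of the field with 2^m elements

vectors : ∀ n → List (Vec Bool n)
vectors zero    = [] ∷ []
vectors (suc n) = List.map (false ∷_) (vectors n) ++ List.map (true ∷_) (vectors n)

∈-vectors : ∀ {n} (v : Vec Bool n) → v ∈ vectors n
∈-vectors []          = here refl
∈-vectors (false ∷ v) = ∈-++⁺ˡ (∈-map⁺ (false ∷_) (∈-vectors v))
∈-vectors (true ∷ v)  = ∈-++⁺ʳ _ (∈-map⁺ (true ∷_) (∈-vectors v))

bit : Fin 2 → Bool
bit zero       = false
bit (suc zero) = true

unbit : Bool → Fin 2
unbit false = zero
unbit true  = suc zero

unbit-bit : ∀ i → unbit (bit i) ≡ i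
unbit-bit zero       = refl
unbit-bit (suc zero) = refl

bit-unbit : ∀ b → bit (unbit b) ≡ b
bit-unbit false = refl
bit-unbit true  = refl

bits : ∀ n → Fin (2 ℕ.^ n) → Vec Bool n
bits zero    _ = []
bits (suc n) i = let h , j = Fin.remQuot (2 ℕ.^ n) i in bit h ∷ bits n j

unbits : ∀ {n} → Vec Bool n → Fin (2 ℕ.^ n)
unbits []      = zero
unbits (b ∷ v) = Fin.combine (unbit b) (unbits v)

bits-unbits : ∀ {n} (v : Vec Bool n) → bits n (unbits v) ≡ v
bits-unbits [] = refl
bits-unbits {suc n} (b ∷ v) = cong₂ _∷_
  (trans (cong (λ p → bit (proj₁ p)) split) (bit-unbit b))
  (trans (cong (λ p → bits n (proj₂ p)) split) (bits-unbits v))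
  where split = Finₚ.remQuot-combine (unbit b) (unbits v)

unbits-bits : ∀ n i → unbits (bits n i) ≡ i
unbits-bits zero    zero = refl
unbits-bits (suc n) i    = trans
  (cong₂ Fin.combine (unbit-bit (proj₁ split)) (unbits-bits n (proj₂ split)))
  (Finₚ.combine-remQuot {2} (2 ℕ.^ n) i)
  where split = Fin.remQuot {2} (2 ℕ.^ n) i

bits-injective : ∀ n {i j} → bits n i ≡ bits n j → i ≡ j
bits-injective n p = trans (sym (unbits-bits n _)) (trans (cong unbits p) (unbits-bits n _))

record BinaryField (m : ℕ) : Set where
  field
    _⊗_ : Op₂ (Vec Bool m)
    𝟙   : Vec Bool m
    isCommutativeRing : IsCommutativeRing _≡_ _⊕_ _⊗_ id 𝟘 𝟙
    𝟙≢𝟘      : 𝟙 ≢ 𝟘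
    integral : ∀ u v → u ⊗ v ≡ 𝟘 → u ≡ 𝟘 ⊎ v ≡ 𝟘

  ring : Char2Ring (Vec Bool m)
  ring = record { isCommutativeRing = isCommutativeRing }

  open Char2 ring using (frob)

  field
    frob-fix : ∀ v → frob m v ≡ v

-- The field `eR` carried by the polynomials of degree below `m`

module FieldFromFiniteRing
  {A : Set} (R : Char2Ring A)
  (_≟_ : DecidableEquality A) (elements : List A) (∈-elements : ∀ r → r ∈ elements)
  (k : ℕ) (fixed : ∀ r → Char2.frob R (suc k) r ≡ r)
  (x : A) (separator≢0 : Degree.separator R x k ≢ Char2Ring.0# R)
  where

  open Char2 R
  open Degree R x
  open Regular k fixed
  open ≡-Reasoning

  private
    m : ℕ
    m = suc k

  private
    y = separator k

    abstract
      idempotent : ∃ λ e → e * e ≡ e × e ≢ 0# × e * (y * ρ y) ≡ e ×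
                           (∀ u v → e * (u * v) ≡ 0# → e * u ≡ 0# ⊎ e * v ≡ 0#)
      -- The refinement starts at the idempotent of `y`, nonzero because `y` is, so that `y` becomes
      -- invertible below the resulting `e`.
      idempotent with refine-idempotent _≟_ elements (y * ρ y) (x*ρ-idem y)
                        (λ p → separator≢0 (trans (sym (x*x*ρ y)) (*-zero-≡ p)))
      ... | e , ee , e≢0 , ey , all =
        e , ee , e≢0 , ey , primitive⇒prime (λ r → All.lookup all (∈-elements r))

    e : A
    e = proj₁ idempotent

    ee : e * e ≡ e
    ee = proj₁ (proj₂ idempotent)

    e≢0 : e ≢ 0#
    e≢0 = proj₁ (proj₂ (proj₂ idempotent))

    ey : e * (y * ρ y) ≡ e
    ey = proj₁ (proj₂ (proj₂ (proj₂ idempotent)))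

    prime : ∀ u v → e * (u * v) ≡ 0# → e * u ≡ 0# ⊎ e * v ≡ 0#
    prime = proj₂ (proj₂ (proj₂ (proj₂ idempotent)))

    e*1≢0 : e * 1# ≢ 0#
    e*1≢0 p = e≢0 (trans (sym (*-identityʳ e)) p)

  -- `y` is invertible below `e`, hence none of its factors can be killed by `e`.
  separated : ∀ d → d ℕ.< k → e * (x + frob (suc d) x) ≢ 0#
  separated d d<k p with separator-factor k d d<k
  ... | c , eq = e≢0 (begin
    e                                         ≡⟨ sym ey ⟩
    e * (y * ρ y)                             ≡⟨ cong (λ z → e * (z * ρ y)) eq ⟩
    e * ((frob (suc d) x + x) * c * ρ y)
      ≡⟨ solve 5 (λ e f x c r → e :* ((f :+ x) :* c :* r) := (c :* r) :* (e :* (x :+ f))) refl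
           e (frob (suc d) x) x c (ρ y) ⟩
    (c * ρ y) * (e * (x + frob (suc d) x))    ≡⟨ *-zero-≡ p ⟩
    0#                                        ∎)

  -- With `j = i + d + 1` the difference is the `i`-th Frobenius image of `x − x^(2^(d+1))`.
  -- Frobenius fixes the idempotent `e` and has trivial kernel because the ring is reduced, so
  -- `separated` applies.
  conjugates-distinct-< : ∀ i j → i ℕ.< j → j ℕ.< m → e * (frob i x + frob j x) ≢ 0#
  conjugates-distinct-< i j i<j j<m p with ℕₚ.m≤n⇒∃[o]m+o≡n i<j
  ... | d , refl = separated d d<k (frob≡0⇒≡0 i (begin
    frob i (e * (x + frob (suc d) x))                ≡⟨ frob-* i _ _ ⟩
    frob i e * frob i (x + frob (suc d) x)           ≡⟨ cong₂ _*_ (frob-idem i ee) (frob-+ i _ _) ⟩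
    e * (frob i x + frob i (frob (suc d) x))         ≡⟨ cong (λ z → e * (frob i x + z)) (sym (frob-∘ i (suc d) x)) ⟩
    e * (frob i x + frob (i ℕ.+ suc d) x)            ≡⟨ cong (λ n → e * (frob i x + frob n x)) (ℕₚ.+-suc i d) ⟩
    e * (frob i x + frob (suc i ℕ.+ d) x)            ≡⟨ p ⟩
    0#                                               ∎))
    where
    d<k : d ℕ.< k
    d<k = ℕₚ.≤-trans (s≤s (ℕₚ.m≤n+m d i)) (ℕₚ.≤-pred j<m)

  conjugates-distinct : ∀ {n} → n ℕ.≤ m → (i j : Fin n) →
                        e * (frob (toℕ i) x + frob (toℕ j) x) ≡ 0# → i ≡ j
  conjugates-distinct n≤m i j p with ℕₚ.<-cmp (toℕ i) (toℕ j)
  ... | tri< i<j _ _ = contradiction p (conjugates-distinct-< _ _ i<j (ℕₚ.<-≤-trans (Finₚ.toℕ<n j) n≤m))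
  ... | tri≈ _ i≡j _ = Finₚ.toℕ-injective i≡j
  ... | tri> _ _ j<i = contradiction (trans (cong (e *_) (+-comm _ _)) p)
                         (conjugates-distinct-< _ _ j<i (ℕₚ.<-≤-trans (Finₚ.toℕ<n i) n≤m))

  private
    F : Set
    F = Vec Bool m

    ⟪_⟫ : F → A
    ⟪ a ⟫ = eval a x

    infix 4 _~_
    -- Equality of the images in the field `eR`.
    _~_ : A → A → Set
    r ~ s = e * r ≡ e * s

  -- A nonzero `a` has some degree `n < m`. If it vanished at `x`, it would vanish at all conjugates
  -- of `x`, of which `n + 1 ≤ m` are distinct; this exceeds the root bound.
  kernel-trivial : ∀ (a : F) → e * ⟪ a ⟫ ≡ 0# → a ≡ 𝟘
  kernel-trivial a p with eval-Pol a
  ... | inj₁ a≡𝟘 = a≡𝟘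
  ... | inj₂ (n , n<m , P) = contradiction
    (root-bound e prime n P (λ i → frob (toℕ i) x) (conjugates-distinct n<m) root) e*1≢0
    where
    root : ∀ i → e * eval a (frob (toℕ i) x) ≡ 0#
    root i = begin
      e * eval a (frob (toℕ i) x)          ≡⟨ cong₂ _*_ (sym (frob-idem (toℕ i) ee)) (eval-frob (toℕ i) a x) ⟩
      frob (toℕ i) e * frob (toℕ i) ⟪ a ⟫  ≡⟨ sym (frob-* (toℕ i) _ _) ⟩
      frob (toℕ i) (e * ⟪ a ⟫)             ≡⟨ cong (frob (toℕ i)) p ⟩
      frob (toℕ i) 0#                      ≡⟨ frob-[] (toℕ i) false ⟩
      0#                                   ∎

  eval-injective : ∀ {a b : F} → e * (⟪ a ⟫ + ⟪ b ⟫) ≡ 0# → a ≡ b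
  eval-injective {a} {b} p = begin
    a             ≡⟨ sym (⊕.identityʳ a) ⟩
    a ⊕ 𝟘         ≡⟨ cong (a ⊕_) (sym (⊕-same b)) ⟩
    a ⊕ (b ⊕ b)   ≡⟨ sym (⊕.assoc a b b) ⟩
    (a ⊕ b) ⊕ b   ≡⟨ cong (_⊕ b) (kernel-trivial (a ⊕ b) (trans (cong (e *_) (eval-xor a b x)) p)) ⟩
    𝟘 ⊕ b         ≡⟨ ⊕.identityˡ b ⟩
    b             ∎

  -- Otherwise r and the 2^m images would be 2^m + 1 distinct roots of X^(2^m) − X.
  eval-surjective : ∀ r → ∃ λ (a : F) → e * (⟪ a ⟫ + r) ≡ 0#
  eval-surjective r with Finₚ.any? (λ i → (e * (⟪ bits m i ⟫ + r)) ≟ 0#)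
  ... | yes (i , p) = bits m i , p
  ... | no none = contradiction
    (root-bound e prime (2 ℕ.^ m) P roots distinct (λ i → *-zero-≡ (≡⇒+≡0 (fixed (roots i))))) e*1≢0
    where
    P : Pol 1# (2 ℕ.^ m) (λ v → frob m v + v)
    P = Pol-+< {m = 1} (ℕₚ.m≤m*n 2 (2 ℕ.^ k) ⦃ ℕₚ.m^n≢0 2 k ⦄) (Pol-ext 1 *-identityʳ (Pol-^ 1)) (Pol-frob m)
    roots : Fin (suc (2 ℕ.^ m)) → A
    roots zero    = r
    roots (suc i) = ⟪ bits m i ⟫
    distinct : ∀ i j → e * (roots i + roots j) ≡ 0# → i ≡ j
    distinct zero    zero    p = refl
    distinct zero    (suc j) p = contradiction (j , trans (cong (e *_) (+-comm _ _)) p) none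
    distinct (suc i) zero    p = contradiction (i , p) none
    distinct (suc i) (suc j) p = cong suc (bits-injective m (eval-injective p))

  -- The unique representative of degree below `m` of a class in `eR`. Through it the field
  -- structure is transported to `Vec Bool m`, where addition is plain `_⊕_`.
  reduce : A → F
  reduce r = proj₁ (eval-surjective r)

  ~⇒ : ∀ {r s} → r ~ s → e * (r + s) ≡ 0#
  ~⇒ p = trans (distribˡ e _ _) (≡⇒+≡0 p)

  ⇒~ : ∀ {r s} → e * (r + s) ≡ 0# → r ~ s
  ⇒~ p = +≡0⇒≡ (trans (sym (distribˡ e _ _)) p)

  reduce~ : ∀ r → ⟪ reduce r ⟫ ~ r
  reduce~ r = ⇒~ (proj₂ (eval-surjective r))

  ~-injective : ∀ {a b : F} → ⟪ a ⟫ ~ ⟪ b ⟫ → a ≡ b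
  ~-injective p = eval-injective (~⇒ p)

  ~-* : ∀ {r r′ s s′} → r ~ r′ → s ~ s′ → r * s ~ r′ * s′
  ~-* {r} {r′} {s} {s′} p q = begin
    e * (r * s)    ≡⟨ sym (*-assoc e r s) ⟩
    e * r * s      ≡⟨ cong (_* s) p ⟩
    e * r′ * s     ≡⟨ solve 3 (λ e r s → e :* r :* s := r :* (e :* s)) refl e r′ s ⟩
    r′ * (e * s)   ≡⟨ cong (r′ *_) q ⟩
    r′ * (e * s′)  ≡⟨ solve 3 (λ e r s → r :* (e :* s) := e :* (r :* s)) refl e r′ s′ ⟩
    e * (r′ * s′)  ∎

  infixl 7 _⊗_
  _⊗_ : F → F → F
  a ⊗ b = reduce (⟪ a ⟫ * ⟪ b ⟫)

  𝟙 : F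
  𝟙 = reduce 1#

  ⟪⊗⟫ : ∀ a b → ⟪ a ⊗ b ⟫ ~ ⟪ a ⟫ * ⟪ b ⟫
  ⟪⊗⟫ a b = reduce~ (⟪ a ⟫ * ⟪ b ⟫)

  ⟪⊕⟫ : ∀ a b → ⟪ a ⊕ b ⟫ ≡ ⟪ a ⟫ + ⟪ b ⟫
  ⟪⊕⟫ a b = eval-xor a b x

  ⊗-comm : ∀ a b → a ⊗ b ≡ b ⊗ a
  ⊗-comm a b = cong reduce (*-comm ⟪ a ⟫ ⟪ b ⟫)

  ⊗-assoc : ∀ a b c → (a ⊗ b) ⊗ c ≡ a ⊗ (b ⊗ c)
  ⊗-assoc a b c = ~-injective (begin
    e * ⟪ (a ⊗ b) ⊗ c ⟫               ≡⟨ ⟪⊗⟫ (a ⊗ b) c ⟩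
    e * (⟪ a ⊗ b ⟫ * ⟪ c ⟫)           ≡⟨ ~-* {s = ⟪ c ⟫} (⟪⊗⟫ a b) refl ⟩
    e * (⟪ a ⟫ * ⟪ b ⟫ * ⟪ c ⟫)       ≡⟨ cong (e *_) (*-assoc _ _ _) ⟩
    e * (⟪ a ⟫ * (⟪ b ⟫ * ⟪ c ⟫))     ≡⟨ sym (~-* {r = ⟪ a ⟫} refl (⟪⊗⟫ b c)) ⟩
    e * (⟪ a ⟫ * ⟪ b ⊗ c ⟫)           ≡⟨ sym (⟪⊗⟫ a (b ⊗ c)) ⟩
    e * ⟪ a ⊗ (b ⊗ c) ⟫               ∎)

  ⊗-identityˡ : ∀ a → 𝟙 ⊗ a ≡ a
  ⊗-identityˡ a = ~-injective (begin
    e * ⟪ 𝟙 ⊗ a ⟫        ≡⟨ ⟪⊗⟫ 𝟙 a ⟩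
    e * (⟪ 𝟙 ⟫ * ⟪ a ⟫)  ≡⟨ ~-* {s = ⟪ a ⟫} (reduce~ 1#) refl ⟩
    e * (1# * ⟪ a ⟫)     ≡⟨ cong (e *_) (*-identityˡ _) ⟩
    e * ⟪ a ⟫            ∎)

  ⊗-distribˡ : ∀ a b c → a ⊗ (b ⊕ c) ≡ a ⊗ b ⊕ a ⊗ c
  ⊗-distribˡ a b c = ~-injective (begin
    e * ⟪ a ⊗ (b ⊕ c) ⟫                       ≡⟨ ⟪⊗⟫ a (b ⊕ c) ⟩
    e * (⟪ a ⟫ * ⟪ b ⊕ c ⟫)                   ≡⟨ cong (λ z → e * (⟪ a ⟫ * z)) (⟪⊕⟫ b c) ⟩
    e * (⟪ a ⟫ * (⟪ b ⟫ + ⟪ c ⟫))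
      ≡⟨ solve 4 (λ e a b c → e :* (a :* (b :+ c)) := e :* (a :* b) :+ e :* (a :* c)) refl e ⟪ a ⟫ ⟪ b ⟫ ⟪ c ⟫ ⟩
    e * (⟪ a ⟫ * ⟪ b ⟫) + e * (⟪ a ⟫ * ⟪ c ⟫) ≡⟨ sym (cong₂ _+_ (⟪⊗⟫ a b) (⟪⊗⟫ a c)) ⟩
    e * ⟪ a ⊗ b ⟫ + e * ⟪ a ⊗ c ⟫             ≡⟨ sym (distribˡ e _ _) ⟩
    e * (⟪ a ⊗ b ⟫ + ⟪ a ⊗ c ⟫)               ≡⟨ cong (e *_) (sym (⟪⊕⟫ (a ⊗ b) (a ⊗ c))) ⟩
    e * ⟪ a ⊗ b ⊕ a ⊗ c ⟫                     ∎)

  ⊗-isCommutativeRing : IsCommutativeRing _≡_ _⊕_ _⊗_ id 𝟘 𝟙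
  ⊗-isCommutativeRing = record
    { isRing = record
      { +-isAbelianGroup = ⊕-isAbelianGroup
      ; *-cong     = cong₂ _⊗_
      ; *-assoc    = ⊗-assoc
      ; *-identity = ⊗-identityˡ , λ a → trans (⊗-comm a 𝟙) (⊗-identityˡ a)
      ; distrib    = ⊗-distribˡ , λ a b c → trans (⊗-comm (b ⊕ c) a)
                       (trans (⊗-distribˡ a b c) (cong₂ _⊕_ (⊗-comm a b) (⊗-comm a c))) }
    ; *-comm = ⊗-comm }

  e*⟪𝟘⟫ : e * ⟪ 𝟘 ⟫ ≡ 0#
  e*⟪𝟘⟫ = *-zero-≡ (eval-0 m x)

  𝟙≢𝟘 : 𝟙 ≢ 𝟘
  𝟙≢𝟘 p = e*1≢0 (trans (sym (reduce~ 1#)) (trans (cong (λ a → e * ⟪ a ⟫) p) e*⟪𝟘⟫))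

  ⊗-integral : ∀ a b → a ⊗ b ≡ 𝟘 → a ≡ 𝟘 ⊎ b ≡ 𝟘
  ⊗-integral a b p = Sum.map (kernel-trivial a) (kernel-trivial b) (prime ⟪ a ⟫ ⟪ b ⟫ (begin
    e * (⟪ a ⟫ * ⟪ b ⟫)  ≡⟨ sym (⟪⊗⟫ a b) ⟩
    e * ⟪ a ⊗ b ⟫        ≡⟨ cong (λ c → e * ⟪ c ⟫) p ⟩
    e * ⟪ 𝟘 ⟫            ≡⟨ e*⟪𝟘⟫ ⟩
    0#                   ∎))

  private
    ⊗-ring : Char2Ring F
    ⊗-ring = record { isCommutativeRing = ⊗-isCommutativeRing }

    module F = Char2 ⊗-ring

  ⟪frob⟫ : ∀ n a → ⟪ F.frob n a ⟫ ~ frob n ⟪ a ⟫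
  ⟪frob⟫ zero    a = refl
  ⟪frob⟫ (suc n) a = trans (⟪⊗⟫ (F.frob n a) (F.frob n a)) (~-* (⟪frob⟫ n a) (⟪frob⟫ n a))

  field-of-order-2^m : BinaryField m
  field-of-order-2^m = record
    { isCommutativeRing = ⊗-isCommutativeRing
    ; 𝟙≢𝟘      = 𝟙≢𝟘
    ; integral = ⊗-integral
    ; frob-fix = λ a → ~-injective (trans (⟪frob⟫ m a) (cong (e *_) (fixed ⟪ a ⟫)))
    }

-- With `m = k + 1` the choice `M = 2^m − 2` serves twice: `2^m = M + 2` makes every element a fixed
-- point of the `m`-th Frobenius map, and the separator, monic of degree exactly `M`, does not wrap
-- around in a ring of dimension `M + 1`.
binaryField : ∀ k → BinaryField (suc k)
binaryField k = FieldFromFiniteRing.field-of-order-2^m C.ring (Vecₚ.≡-dec 𝔹ₚ._≟_) (vectors (suc M)) ∈-vectors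
  k (C.frob-fix (suc k) (sym (2+degree k))) C.x separator≢0
  where
  M = degree k
  module C = Cyclic M
  open Degree C.ring C.x
  separator≢0 : separator k ≢ 𝟘
  separator≢0 p with Monic-separator k
  ... | _ , (q , refl) , eq = C.eval+x^M≢0 q (trans (sym eq) p)

open import Defs
open import Data.Integer as ℤ using (ℤ; +_; 0ℤ; 1ℤ; -1ℤ)
import Data.Integer.Properties as ℤₚ
import Data.Integer.Solver

-- Sums over 𝔽₂ⁿ

module ℤ-Solver = Data.Integer.Solver.+-*-Solver


sum : ∀ {n} → (Vec Bool n → ℤ) → ℤ
sum {zero}  f = f []
sum {suc n} f = sum (λ v → f (false ∷ v)) ℤ.+ sum (λ v → f (true ∷ v))

sum-cong : ∀ {n} {f g : Vec Bool n → ℤ} → (∀ v → f v ≡ g v) → sum f ≡ sum g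
sum-cong {zero}  eq = eq []
sum-cong {suc n} eq = cong₂ ℤ._+_ (sum-cong (λ v → eq (false ∷ v))) (sum-cong (λ v → eq (true ∷ v)))

+-interchange : ∀ a b c d → (a ℤ.+ b) ℤ.+ (c ℤ.+ d) ≡ (a ℤ.+ c) ℤ.+ (b ℤ.+ d)
+-interchange = solve 4 (λ a b c d → (a :+ b) :+ (c :+ d) := (a :+ c) :+ (b :+ d)) refl
  where open ℤ-Solver

sum-+ : ∀ {n} (f g : Vec Bool n → ℤ) → sum (λ v → f v ℤ.+ g v) ≡ sum f ℤ.+ sum g
sum-+ {zero}  f g = refl
sum-+ {suc n} f g = trans
  (cong₂ ℤ._+_ (sum-+ (λ v → f (false ∷ v)) (λ v → g (false ∷ v)))
               (sum-+ (λ v → f (true ∷ v)) (λ v → g (true ∷ v))))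
  (+-interchange (sum (λ v → f (false ∷ v))) _ _ _)

sum-*ˡ : ∀ {n} c (f : Vec Bool n → ℤ) → sum (λ v → c ℤ.* f v) ≡ c ℤ.* sum f
sum-*ˡ {zero}  c f = refl
sum-*ˡ {suc n} c f = trans
  (cong₂ ℤ._+_ (sum-*ˡ c (λ v → f (false ∷ v))) (sum-*ˡ c (λ v → f (true ∷ v))))
  (sym (ℤₚ.*-distribˡ-+ c _ _))

sum-swap : ∀ {m n} (f : Vec Bool m → Vec Bool n → ℤ) →
           sum (λ u → sum (λ v → f u v)) ≡ sum (λ v → sum (λ u → f u v))
sum-swap {zero}  f = refl
sum-swap {suc m} f = trans
  (cong₂ ℤ._+_ (sum-swap (λ u → f (false ∷ u))) (sum-swap (λ u → f (true ∷ u))))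
  (sym (sum-+ (λ v → sum (λ u → f (false ∷ u) v)) (λ v → sum (λ u → f (true ∷ u) v))))

sum-*-sum : ∀ {m n} (f : Vec Bool m → ℤ) (g : Vec Bool n → ℤ) →
            sum f ℤ.* sum g ≡ sum (λ u → sum (λ v → f u ℤ.* g v))
sum-*-sum f g = begin
  sum f ℤ.* sum g                        ≡⟨ ℤₚ.*-comm (sum f) (sum g) ⟩
  sum g ℤ.* sum f                        ≡⟨ sum-*ˡ (sum g) f ⟨
  sum (λ u → sum g ℤ.* f u)              ≡⟨ sum-cong (λ u → ℤₚ.*-comm (sum g) (f u)) ⟩
  sum (λ u → f u ℤ.* sum g)              ≡⟨ sum-cong (λ u → sym (sum-*ˡ (f u) g)) ⟩
  sum (λ u → sum (λ v → f u ℤ.* g v))    ∎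
  where open ≡-Reasoning

sum-const : ∀ n c → sum {n} (λ _ → c) ≡ + (2 ℕ.^ n) ℤ.* c
sum-const zero    c = sym (ℤₚ.*-identityˡ c)
sum-const (suc n) c = begin
  sum {n} (λ _ → c) ℤ.+ sum {n} (λ _ → c)     ≡⟨ cong₂ ℤ._+_ (sum-const n c) (sum-const n c) ⟩
  + q ℤ.* c ℤ.+ + q ℤ.* c                     ≡⟨ sym (ℤₚ.*-distribʳ-+ c (+ q) (+ q)) ⟩
  (+ q ℤ.+ + q) ℤ.* c                         ≡⟨ cong (λ x → (+ q ℤ.+ + x) ℤ.* c) (sym (ℕₚ.+-identityʳ q)) ⟩
  + (2 ℕ.^ suc n) ℤ.* c                       ∎
  where
  open ≡-Reasoning
  q = 2 ℕ.^ n

sum-0 : ∀ {n} {f : Vec Bool n → ℤ} → (∀ v → f v ≡ 0ℤ) → sum f ≡ 0ℤ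
sum-0 {n} eq = trans (sum-cong eq) (trans (sum-const n 0ℤ) (ℤₚ.*-zeroʳ (+ (2 ℕ.^ n))))

sum-translate : ∀ {n} a (f : Vec Bool n → ℤ) → sum (λ v → f (a ⊕ v)) ≡ sum f
sum-translate []          f = refl
sum-translate (false ∷ a) f =
  cong₂ ℤ._+_ (sum-translate a (λ v → f (false ∷ v))) (sum-translate a (λ v → f (true ∷ v)))
sum-translate (true ∷ a)  f = trans
  (cong₂ ℤ._+_ (sum-translate a (λ v → f (true ∷ v))) (sum-translate a (λ v → f (false ∷ v))))
  (ℤₚ.+-comm (sum (λ v → f (true ∷ v))) _)

sum-point : ∀ {n} a (f : Vec Bool n → ℤ) → (∀ v → v ≢ a → f v ≡ 0ℤ) → sum f ≡ f a
sum-point []          f eq = refl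
sum-point (false ∷ a) f eq = trans
  (cong₂ ℤ._+_ (sum-point a (λ v → f (false ∷ v)) (λ v v≢a → eq _ λ { refl → v≢a refl }))
               (sum-0 λ v → eq (true ∷ v) λ ()))
  (ℤₚ.+-identityʳ _)
sum-point (true ∷ a)  f eq = trans
  (cong₂ ℤ._+_ (sum-0 λ v → eq (false ∷ v) λ ())
               (sum-point a (λ v → f (true ∷ v)) (λ v v≢a → eq _ λ { refl → v≢a refl })))
  (ℤₚ.+-identityˡ _)

infix 4 _≟ᵥ_
_≟ᵥ_ : ∀ {n} → DecidableEquality (Vec Bool n)
_≟ᵥ_ = Vecₚ.≡-dec 𝔹ₚ._≟_

-- `f` is split into its part at `a` and the remainder, which is supported at `b`; each is a
-- one-point sum.
sum-two-points : ∀ {n} a b (f : Vec Bool n → ℤ) → a ≢ b →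
                 (∀ v → v ≢ a → v ≢ b → f v ≡ 0ℤ) → sum f ≡ f a ℤ.+ f b
sum-two-points a b f a≢b eq = begin
  sum f                      ≡⟨ sum-cong split ⟩
  sum (λ v → g v ℤ.+ h v)    ≡⟨ sum-+ g h ⟩
  sum g ℤ.+ sum h            ≡⟨ cong₂ ℤ._+_ (sum-point a g (λ v → g-off v)) (sum-point b h h-off) ⟩
  g a ℤ.+ h b                ≡⟨ cong₂ ℤ._+_ g-a h-b ⟩
  f a ℤ.+ f b                ∎
  where
  open ≡-Reasoning
  g h : Vec Bool _ → ℤ
  g v = if does (v ≟ᵥ a) then f v else 0ℤ
  h v = if does (v ≟ᵥ a) then 0ℤ else f v
  split : ∀ v → f v ≡ g v ℤ.+ h v
  split v with does (v ≟ᵥ a)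
  ... | true  = sym (ℤₚ.+-identityʳ _)
  ... | false = sym (ℤₚ.+-identityˡ _)
  g-off : ∀ v → v ≢ a → g v ≡ 0ℤ
  g-off v v≢a rewrite dec-false (v ≟ᵥ a) v≢a = refl
  h-off : ∀ v → v ≢ b → h v ≡ 0ℤ
  h-off v v≢b with v ≟ᵥ a
  ... | yes _   = refl
  ... | no v≢a = eq v v≢a v≢b
  g-a : g a ≡ f a
  g-a rewrite dec-true (a ≟ᵥ a) refl = refl
  h-b : h b ≡ f b
  h-b rewrite dec-false (b ≟ᵥ a) (a≢b ∘ sym) = refl

-- Sums over `Fin` and their comparison with sums over bit vectors

∑-cong : ∀ {n} {f g : Fin n → ℤ} → (∀ i → f i ≡ g i) → ∑ f ≡ ∑ g
∑-cong {zero}  eq = refl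
∑-cong {suc n} eq = cong₂ ℤ._+_ (eq zero) (∑-cong (eq ∘ suc))

∑-*ˡ : ∀ {n} c (f : Fin n → ℤ) → ∑ (λ i → c ℤ.* f i) ≡ c ℤ.* ∑ f
∑-*ˡ {zero}  c f = sym (ℤₚ.*-zeroʳ c)
∑-*ˡ {suc n} c f = trans (cong (λ z → c ℤ.* f zero ℤ.+ z) (∑-*ˡ c (f ∘ suc))) (sym (ℤₚ.*-distribˡ-+ c _ _))

∑-++ : ∀ m {n} (f : Fin (m ℕ.+ n) → ℤ) → ∑ f ≡ ∑ (λ i → f (i Fin.↑ˡ n)) ℤ.+ ∑ (λ j → f (m Fin.↑ʳ j))
∑-++ zero    f = sym (ℤₚ.+-identityˡ _)
∑-++ (suc m) f = trans (cong (λ z → f zero ℤ.+ z) (∑-++ m (f ∘ suc))) (sym (ℤₚ.+-assoc (f zero) _ _))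

∑-combine : ∀ n (f : Fin (2 ℕ.* n) → ℤ) →
            ∑ f ≡ ∑ (λ j → f (Fin.combine {2} {n} zero j)) ℤ.+ ∑ (λ j → f (Fin.combine {2} {n} (suc zero) j))
∑-combine n f = trans (∑-++ n {n ℕ.+ 0} f)
  (cong (λ z → ∑ (λ (j : Fin n) → f (j Fin.↑ˡ (n ℕ.+ 0))) ℤ.+ z)
    -- `2 * n` unfolds to `n + (n + 0)`, so the second half carries an empty tail.
    (trans (∑-++ n {0} (λ j → f (n Fin.↑ʳ j))) (ℤₚ.+-identityʳ _)))

∑-bits : ∀ n (f : Vec Bool n → ℤ) → ∑ (λ i → f (bits n i)) ≡ sum f
∑-bits zero    f = ℤₚ.+-identityʳ _
∑-bits (suc n) f = trans (∑-combine (2 ℕ.^ n) (λ i → f (bits (suc n) i))) (cong₂ ℤ._+_ (half false) (half true))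
  where
  half : ∀ b → ∑ (λ j → f (bits (suc n) (Fin.combine {2} {2 ℕ.^ n} (unbit b) j))) ≡ sum (λ v → f (b ∷ v))
  half b = trans (∑-cong head) (∑-bits n (λ v → f (b ∷ v)))
    where
    head : ∀ j → f (bits (suc n) (Fin.combine {2} {2 ℕ.^ n} (unbit b) j)) ≡ f (b ∷ bits n j)
    head j = trans (cong (λ (h , l) → f (bit h ∷ bits n l)) (Finₚ.remQuot-combine {2} (unbit b) j))
                   (cong (λ h → f (h ∷ bits n j)) (bit-unbit b))

-- Trace and additive character

module Field {k : ℕ} (𝔽 : BinaryField (suc k)) where
  open BinaryField 𝔽 using (ring; 𝟙≢𝟘; integral; frob-fix)
  open Char2 ring public
  open Regular k frob-fix using (ρ; x*x*ρ; sq≡0⇒≡0)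
  open ≡-Reasoning

  private
    m : ℕ
    m = suc k

  F : Set
  F = Vec Bool m

  nonzero-cancel : ∀ {x y} → x ≢ 0# → x * y ≡ 0# → y ≡ 0#
  nonzero-cancel {x} {y} x≢0 p = Sum.[ (λ x≡0 → contradiction x≡0 x≢0) , id ]′ (integral x y p)

  cancelˡ : ∀ {x y z} → x ≢ 0# → x * y ≡ x * z → y ≡ z
  cancelˡ {x} x≢0 p = +≡0⇒≡ (nonzero-cancel x≢0 (trans (distribˡ x _ _) (≡⇒+≡0 p)))

  abstract
    -- Cancelling `c` in `c (c ρ(c)) = c` shows that the quasi-inverse is a true inverse.
    inverse : ∀ c → c ≢ 0# → ∃ λ d → c * d ≡ 1#
    inverse c c≢0 = ρ c , +≡0⇒≡ (nonzero-cancel c≢0 (begin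
      c * (c * ρ c + 1#)    ≡⟨ solve 2 (λ c r → c :* (c :* r :+ con true) := c :* (c :* r) :+ c) refl c (ρ c) ⟩
      c * (c * ρ c) + c     ≡⟨ ≡⇒+≡0 (x*x*ρ c) ⟩
      0#                    ∎))

  sq-injective : ∀ {a b} → a * a ≡ b * b → a ≡ b
  sq-injective {a} {b} p = +≡0⇒≡ (sq≡0⇒≡0 (begin
    (a + b) * (a + b)    ≡⟨ solve 2 (λ a b → (a :+ b) :* (a :+ b) := a :* a :+ b :* b) refl a b ⟩
    a * a + b * b        ≡⟨ ≡⇒+≡0 p ⟩
    0#                   ∎))

  -- The power `2^(m−1)`, whose square is the power `2^m`, the identity.
  √ : F → F
  √ = frob k

  √-sq : ∀ c → √ c * √ c ≡ c
  √-sq = frob-fix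

  partialTrace : ℕ → F → F
  partialTrace zero    z = 0#
  partialTrace (suc n) z = partialTrace n z + frob n z

  partialTrace-+ : ∀ n a b → partialTrace n (a + b) ≡ partialTrace n a + partialTrace n b
  partialTrace-+ zero    a b = sym (+-identityˡ 0#)
  partialTrace-+ (suc n) a b = begin
    partialTrace n (a + b) + frob n (a + b)
      ≡⟨ cong₂ _+_ (partialTrace-+ n a b) (frob-+ n a b) ⟩
    (partialTrace n a + partialTrace n b) + (frob n a + frob n b)
      ≡⟨ ⊕-interchange (partialTrace n a) _ _ _ ⟩
    (partialTrace n a + frob n a) + (partialTrace n b + frob n b) ∎

  partialTrace-sq : ∀ n z → partialTrace n (z * z) ≡ partialTrace n z * partialTrace n z
  partialTrace-sq zero    z = sym (zeroˡ 0#)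
  partialTrace-sq (suc n) z = begin
    partialTrace n (z * z) + frob n (z * z)
      ≡⟨ cong₂ _+_ (partialTrace-sq n z) (frob-* n z z) ⟩
    partialTrace n z * partialTrace n z + frob n z * frob n z
      ≡⟨ solve 2 (λ a b → a :* a :+ b :* b := (a :+ b) :* (a :+ b)) refl (partialTrace n z) (frob n z) ⟩
    (partialTrace n z + frob n z) * (partialTrace n z + frob n z) ∎

  -- Squaring moves each summand `z^(2^i)` to the next one, so the sum loses `z` and gains
  -- `z^(2^n)`. At `n = m` these cancel, which makes the trace idempotent and hence 0 or 1.
  partialTrace-sq-telescope : ∀ n z → partialTrace n z * partialTrace n z ≡ partialTrace n z + (z + frob n z)
  partialTrace-sq-telescope zero    z = trans (zeroˡ 0#) (sym (trans (+-identityˡ _) (x+x≡0 z)))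
  partialTrace-sq-telescope (suc n) z = begin
    (T + f) * (T + f)                ≡⟨ solve 2 (λ T f → (T :+ f) :* (T :+ f) := T :* T :+ f :* f) refl T f ⟩
    T * T + f * f                    ≡⟨ cong (λ u → u + f * f) (partialTrace-sq-telescope n z) ⟩
    T + (z + f) + f * f              ≡⟨ solve 4 (λ T z f g → T :+ (z :+ f) :+ g := (T :+ f) :+ (z :+ g)) refl T z f (f * f) ⟩
    (T + f) + (z + f * f)            ∎
    where
    T = partialTrace n z
    f = frob n z

  Pol-partialTrace : ∀ n → Pol 1# (2 ℕ.^ n) (partialTrace (suc n))
  Pol-partialTrace zero    =
    Pol-ext 1 (λ z → trans (*-identityʳ z) (sym (+-identityˡ z))) (Pol-^ 1)
  Pol-partialTrace (suc n) = Pol-ext (2 ℕ.^ suc n) (λ z → +-comm (frob (suc n) z) _)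
    (Pol-+< (ℕₚ.^-monoʳ-< 2 (s≤s (s≤s z≤n)) (ℕₚ.n<1+n n)) (Pol-partialTrace n) (Pol-frob (suc n)))

  tr : F → F
  tr = partialTrace m

  tr-+ : ∀ a b → tr (a + b) ≡ tr a + tr b
  tr-+ = partialTrace-+ m

  tr-idem : ∀ z → tr z * tr z ≡ tr z
  tr-idem z = begin
    tr z * tr z           ≡⟨ partialTrace-sq-telescope m z ⟩
    tr z + (z + frob m z) ≡⟨ cong (λ u → tr z + u) (≡⇒+≡0 (sym (frob-fix z))) ⟩
    tr z + 0#             ≡⟨ +-identityʳ _ ⟩
    tr z                  ∎

  tr-sq : ∀ z → tr (z * z) ≡ tr z
  tr-sq z = trans (partialTrace-sq m z) (tr-idem z)

  tr-01 : ∀ z → tr z ≡ 0# ⊎ tr z ≡ 1#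
  tr-01 z = Sum.map₂ +≡0⇒≡ (integral (tr z) (tr z + 1#) (begin
    tr z * (tr z + 1#)    ≡⟨ solve 1 (λ t → t :* (t :+ con true) := t :* t :+ t) refl (tr z) ⟩
    tr z * tr z + tr z    ≡⟨ ≡⇒+≡0 (tr-idem z) ⟩
    0#                    ∎))

  -- The trace is a monic polynomial of degree `2^(m−1)`, fewer than the `2^m` elements available as
  -- roots. The root bound is used with `e = 1`, where its primality condition is integrality of the
  -- field.
  tr-nonzero : ∃ λ z → tr z ≢ 0#
  tr-nonzero with Finₚ.any? (λ i → ¬? (tr (bits m i) ≟ᵥ 0#))
  ... | yes (i , p) = bits m i , p
  ... | no none = contradiction
    (trans (sym (*-identityʳ 1#)) (root-bound 1# prime (2 ℕ.^ k) (Pol-partialTrace k) root distinct vanish)) 𝟙≢𝟘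
    where
    1*⇒ : ∀ {u} → 1# * u ≡ 0# → u ≡ 0#
    1*⇒ = trans (sym (*-identityˡ _))
    ⇒1* : ∀ {u} → u ≡ 0# → 1# * u ≡ 0#
    ⇒1* = trans (*-identityˡ _)
    prime : ∀ u v → 1# * (u * v) ≡ 0# → 1# * u ≡ 0# ⊎ 1# * v ≡ 0#
    prime u v p = Sum.map ⇒1* ⇒1* (integral u v (1*⇒ p))
    2^k<2^m : 2 ℕ.^ k ℕ.< 2 ℕ.^ m
    2^k<2^m = ℕₚ.^-monoʳ-< 2 (s≤s (s≤s z≤n)) (ℕₚ.n<1+n k)
    root : Fin (suc (2 ℕ.^ k)) → F
    root i = bits m (Fin.inject≤ i 2^k<2^m)
    distinct : ∀ i j → 1# * (root i + root j) ≡ 0# → i ≡ j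
    distinct i j p = Finₚ.inject≤-injective 2^k<2^m 2^k<2^m i j (bits-injective m (+≡0⇒≡ (1*⇒ p)))
    vanish : ∀ i → 1# * tr (root i) ≡ 0#
    vanish i = ⇒1* (decidable-stable (tr (root i) ≟ᵥ 0#) (λ p → none (_ , p)))

  χ : F → ℤ
  χ z = if does (tr z ≟ᵥ 0#) then 1ℤ else -1ℤ

  χ-tr0 : ∀ {z} → tr z ≡ 0# → χ z ≡ 1ℤ
  χ-tr0 {z} p rewrite dec-true (tr z ≟ᵥ 0#) p = refl

  χ-tr≢0 : ∀ {z} → tr z ≢ 0# → χ z ≡ -1ℤ
  χ-tr≢0 {z} p rewrite dec-false (tr z ≟ᵥ 0#) p = refl

  χ-tr1 : ∀ {z} → tr z ≡ 1# → χ z ≡ -1ℤ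
  χ-tr1 p = χ-tr≢0 (λ q → 𝟙≢𝟘 (trans (sym p) q))

  χ-±1 : ∀ z → χ z ≡ 1ℤ ⊎ χ z ≡ -1ℤ
  χ-±1 z = Sum.map χ-tr0 χ-tr1 (tr-01 z)

  χ-+ : ∀ a b → χ (a + b) ≡ χ a ℤ.* χ b
  χ-+ a b = cases (tr-01 a) (tr-01 b)
    where
    cases : tr a ≡ 0# ⊎ tr a ≡ 1# → tr b ≡ 0# ⊎ tr b ≡ 1# → χ (a + b) ≡ χ a ℤ.* χ b
    cases (inj₁ p) (inj₁ q) = trans
      (χ-tr0 (trans (tr-+ a b) (trans (cong₂ _+_ p q) (+-identityˡ 0#)))) (sym (cong₂ ℤ._*_ (χ-tr0 p) (χ-tr0 q)))
    cases (inj₁ p) (inj₂ q) = trans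
      (χ-tr1 (trans (tr-+ a b) (trans (cong₂ _+_ p q) (+-identityˡ 1#)))) (sym (cong₂ ℤ._*_ (χ-tr0 p) (χ-tr1 q)))
    cases (inj₂ p) (inj₁ q) = trans
      (χ-tr1 (trans (tr-+ a b) (trans (cong₂ _+_ p q) (+-identityʳ 1#)))) (sym (cong₂ ℤ._*_ (χ-tr1 p) (χ-tr0 q)))
    cases (inj₂ p) (inj₂ q) = trans
      (χ-tr0 (trans (tr-+ a b) (trans (cong₂ _+_ p q) (x+x≡0 1#)))) (sym (cong₂ ℤ._*_ (χ-tr1 p) (χ-tr1 q)))

  χ-sq : ∀ z → χ (z * z) ≡ χ z
  χ-sq z = cong (λ u → if does (u ≟ᵥ 0#) then 1ℤ else -1ℤ) (tr-sq z)

  χ-0 : χ 0# ≡ 1ℤ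
  χ-0 = χ-tr0 (begin
    tr 0#             ≡⟨ cong tr (x+x≡0 0#) ⟨
    tr (0# + 0#)      ≡⟨ tr-+ 0# 0# ⟩
    tr 0# + tr 0#     ≡⟨ x+x≡0 (tr 0#) ⟩
    0#                ∎)

  sum-χ-0 : ∀ {c} → c ≡ 0# → sum (λ v → χ (c * v)) ≡ + (2 ℕ.^ m)
  sum-χ-0 refl = begin
    sum (λ v → χ (0# * v))     ≡⟨ sum-cong (λ v → trans (cong χ (zeroˡ v)) χ-0) ⟩
    sum {m} (λ v → 1ℤ)         ≡⟨ sum-const m 1ℤ ⟩
    + (2 ℕ.^ m) ℤ.* 1ℤ         ≡⟨ ℤₚ.*-identityʳ _ ⟩
    + (2 ℕ.^ m)                ∎

  -- Translating `v` by `c⁻¹ z`, with `z` of nonzero trace, multiplies every term by -1, so the sum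
  -- equals its own negative.
  sum-χ-≢0 : ∀ {c} → c ≢ 0# → sum (λ v → χ (c * v)) ≡ 0ℤ
  sum-χ-≢0 {c} c≢0 with inverse c c≢0 | tr-nonzero
  ... | d , cd≡1 | z , trz≢0 = self-negative (begin
    sum (λ v → χ (c * v))               ≡⟨ sum-translate (d * z) (λ v → χ (c * v)) ⟨
    sum (λ v → χ (c * (d * z + v)))     ≡⟨ sum-cong shifted ⟩
    sum (λ v → -1ℤ ℤ.* χ (c * v))       ≡⟨ sum-*ˡ -1ℤ (λ v → χ (c * v)) ⟩
    -1ℤ ℤ.* sum (λ v → χ (c * v))       ∎)
    where
    self-negative : ∀ {i} → i ≡ -1ℤ ℤ.* i → i ≡ 0ℤ
    self-negative {+ zero}     p = refl
    shifted : ∀ v → χ (c * (d * z + v)) ≡ -1ℤ ℤ.* χ (c * v)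
    shifted v = begin
      χ (c * (d * z + v))       ≡⟨ cong χ (solve 4 (λ c d z v → c :* (d :* z :+ v) := (c :* d) :* z :+ c :* v) refl c d z v) ⟩
      χ ((c * d) * z + c * v)   ≡⟨ cong (λ u → χ (u * z + c * v)) cd≡1 ⟩
      χ (1# * z + c * v)        ≡⟨ cong (λ u → χ (u + c * v)) (*-identityˡ z) ⟩
      χ (z + c * v)             ≡⟨ χ-+ z (c * v) ⟩
      χ z ℤ.* χ (c * v)         ≡⟨ cong (ℤ._* χ (c * v)) (χ-tr≢0 trz≢0) ⟩
      -1ℤ ℤ.* χ (c * v)         ∎

-- The sums Σ χ(b z³ + u z)

module OddDegree (t : ℕ) (𝔽 : BinaryField (suc (t ℕ.* 2))) where
  open BinaryField 𝔽 using (𝟙≢𝟘; frob-fix)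
  open Field 𝔽
  open ≡-Reasoning

  private
    m : ℕ
    m = suc (t ℕ.* 2)

  cube : F → F
  cube z = z * z * z

  -- x ^ (1 + 4 + ⋯ + 4ⁿ); at n = t this inverts the cube, as
  -- 3 (1 + 4 + ⋯ + 4ᵗ) = 2 (2^m − 1) + 1.
  geometric : ℕ → F → F
  geometric zero    x = x
  geometric (suc n) x = x * frob 2 (geometric n x)

  -- The exponents satisfy `1 + 3 (1 + 4 + ⋯ + 4ⁿ) = 4^(n+1)`. The inductive step is
  -- `x (x g⁴)³ = (x g³)⁴`.
  x*cube-geometric : ∀ n x → x * cube (geometric n x) ≡ frob (suc n ℕ.* 2) x
  x*cube-geometric zero    x = solve 1 (λ x → x :* (x :* x :* x) := (x :* x) :* (x :* x)) refl x
  x*cube-geometric (suc n) x = begin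
    x * cube (x * ((g * g) * (g * g)))
      ≡⟨ solve 2 (λ x g → let h = x :* ((g :* g) :* (g :* g)) ; y = x :* (g :* g :* g) in
           x :* (h :* h :* h) := (y :* y) :* (y :* y)) refl x g ⟩
    frob 2 (x * cube g)
      ≡⟨ cong (frob 2) (x*cube-geometric n x) ⟩
    frob (suc (suc n) ℕ.* 2) x ∎
    where g = geometric n x

  x*geometric-cube : ∀ n x → x * geometric n (cube x) ≡ frob (suc n ℕ.* 2) x
  x*geometric-cube zero    x = solve 1 (λ x → x :* (x :* x :* x) := (x :* x) :* (x :* x)) refl x
  x*geometric-cube (suc n) x = begin
    x * (cube x * ((g * g) * (g * g)))
      ≡⟨ solve 2 (λ x g → let y = x :* g in
           x :* (x :* x :* x :* ((g :* g) :* (g :* g))) := (y :* y) :* (y :* y)) refl x g ⟩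
    frob 2 (x * g)
      ≡⟨ cong (frob 2) (x*geometric-cube n x) ⟩
    frob (suc (suc n) ℕ.* 2) x ∎
    where g = geometric n (cube x)

  -- Here the oddness of `m` enters: `2 (t + 1) = m + 1`, so this power is the identity followed by
  -- one squaring. After cancelling `x`, cubing and `geometric t` are mutually inverse on nonzero
  -- elements.
  frob-suc-m : ∀ x → frob (suc t ℕ.* 2) x ≡ x * x
  frob-suc-m x = cong₂ _*_ (frob-fix x) (frob-fix x)

  cube-cuberoot : ∀ {x} → x ≢ 0# → cube (geometric t x) ≡ x
  cube-cuberoot {x} x≢0 = cancelˡ x≢0 (trans (x*cube-geometric t x) (frob-suc-m x))

  cuberoot-cube : ∀ {x} → x ≢ 0# → geometric t (cube x) ≡ x
  cuberoot-cube {x} x≢0 = cancelˡ x≢0 (trans (x*geometric-cube t x) (frob-suc-m x))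

  q : ℤ
  q = + (2 ℕ.^ m)

  exponent : F → F → F → F
  exponent b u z = b * cube z + u * z

  S : F → F → ℤ
  S b u = sum (λ z → χ (exponent b u z))

  -- Polarisation of the cubic: in characteristic 2 the pure `z` terms cancel and the coefficients 3
  -- become 1.
  exponent-shift : ∀ b u z w → exponent b u z + exponent b u (z + w) ≡
                   exponent b u w + (b * w * (z * z) + b * (w * w) * z)
  exponent-shift = solve 4 (λ b u z w →
    (b :* (z :* z :* z) :+ u :* z) :+ (b :* ((z :+ w) :* (z :+ w) :* (z :+ w)) :+ u :* (z :+ w)) :=
    (b :* (w :* w :* w) :+ u :* w) :+ (b :* w :* (z :* z) :+ b :* (w :* w) :* z)) refl

  -- χ turns the term b w z² into √(b w) z, so the form is linear in z.
  polar : F → F → F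
  polar b w = √ (b * w) + b * (w * w)

  χ-polar : ∀ b w z → χ (b * w * (z * z) + b * (w * w) * z) ≡ χ (polar b w * z)
  χ-polar b w z = begin
    χ (b * w * (z * z) + b * (w * w) * z)
      ≡⟨ χ-+ _ _ ⟩
    χ (b * w * (z * z)) ℤ.* χ (b * (w * w) * z)
      ≡⟨ cong (λ c → χ (c * (z * z)) ℤ.* χ (b * (w * w) * z)) (sym (√-sq (b * w))) ⟩
    χ (s * s * (z * z)) ℤ.* χ (b * (w * w) * z)
      ≡⟨ cong (λ c → χ c ℤ.* χ (b * (w * w) * z))
           (solve 2 (λ s z → s :* s :* (z :* z) := (s :* z) :* (s :* z)) refl s z) ⟩
    χ ((s * z) * (s * z)) ℤ.* χ (b * (w * w) * z)
      ≡⟨ cong (ℤ._* χ (b * (w * w) * z)) (χ-sq (s * z)) ⟩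
    χ (s * z) ℤ.* χ (b * (w * w) * z)
      ≡⟨ sym (χ-+ _ _) ⟩
    χ (s * z + b * (w * w) * z)
      ≡⟨ cong χ (sym (distribʳ z s _)) ⟩
    χ (polar b w * z) ∎
    where s = √ (b * w)

  -- Squaring removes the root: `(√(b w) + b w²)² = b w + b² w⁴`. Since squaring is injective, the
  -- factorisation exhibits the zeros of `polar b`.
  polar-sq : ∀ b w → polar b w * polar b w ≡ b * w * (b * cube w + 1#)
  polar-sq b w = begin
    polar b w * polar b w
      ≡⟨ solve 3 (λ s b w → (s :+ b :* (w :* w)) :* (s :+ b :* (w :* w)) :=
                   s :* s :+ b :* w :* (b :* (w :* w :* w))) refl (√ (b * w)) b w ⟩
    √ (b * w) * √ (b * w) + b * w * (b * cube w)
      ≡⟨ cong (λ u → u + b * w * (b * cube w)) (√-sq (b * w)) ⟩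
    b * w + b * w * (b * cube w)
      ≡⟨ solve 2 (λ u v → u :+ u :* v := u :* (v :+ con true)) refl (b * w) (b * cube w) ⟩
    b * w * (b * cube w + 1#) ∎

  -- The second variable is replaced by `z + w` and the exponents are polarised. For fixed `w` the
  -- dependence on `z` is then a linear character, whose sum detects whether `w` lies in the
  -- radical.
  S² : ∀ b u → S b u ℤ.* S b u ≡ sum (λ w → χ (exponent b u w) ℤ.* sum (λ z → χ (polar b w * z)))
  S² b u = begin
    S b u ℤ.* S b u
      ≡⟨ sum-*-sum E E ⟩
    sum (λ z → sum (λ w → E z ℤ.* E w))
      ≡⟨ sum-cong (λ z → sym (sum-translate z (λ w → E z ℤ.* E w))) ⟩
    sum (λ z → sum (λ w → E z ℤ.* E (z + w)))
      ≡⟨ sum-cong (λ z → sum-cong (λ w → factor z w)) ⟩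
    sum (λ z → sum (λ w → E w ℤ.* χ (polar b w * z)))
      ≡⟨ sum-swap (λ z w → E w ℤ.* χ (polar b w * z)) ⟩
    sum (λ w → sum (λ z → E w ℤ.* χ (polar b w * z)))
      ≡⟨ sum-cong (λ w → sum-*ˡ (E w) (λ z → χ (polar b w * z))) ⟩
    sum (λ w → E w ℤ.* sum (λ z → χ (polar b w * z))) ∎
    where
    E : F → ℤ
    E z = χ (exponent b u z)
    factor : ∀ z w → E z ℤ.* E (z + w) ≡ E w ℤ.* χ (polar b w * z)
    factor z w = begin
      E z ℤ.* E (z + w)                                             ≡⟨ sym (χ-+ _ _) ⟩
      χ (exponent b u z + exponent b u (z + w))                     ≡⟨ cong χ (exponent-shift b u z w) ⟩
      χ (exponent b u w + (b * w * (z * z) + b * (w * w) * z))      ≡⟨ χ-+ _ _ ⟩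
      E w ℤ.* χ (b * w * (z * z) + b * (w * w) * z)                 ≡⟨ cong (λ c → E w ℤ.* c) (χ-polar b w z) ⟩
      E w ℤ.* χ (polar b w * z)                                     ∎

  -- The witness is the cube root of `b⁻¹`; it is unique because cubing is injective on nonzero
  -- elements.
  inverse-cuberoot : ∀ {b} → b ≢ 0# → ∃ λ r →
    r ≢ 0# × b * cube r ≡ 1# × (∀ {w} → w ≢ 0# → b * cube w ≡ 1# → w ≡ r)
  inverse-cuberoot {b} b≢0 = geometric t β
    , (λ r≡0 → 𝟙≢𝟘 (trans (sym br³) (*-zero-≡ (*-zero-≡ r≡0))))
    , br³
    , λ w≢0 p → trans (sym (cuberoot-cube w≢0)) (cong (geometric t) (cancelˡ b≢0 (trans p (sym bβ))))
    where
    β : F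
    β = proj₁ (inverse b b≢0)
    bβ : b * β ≡ 1#
    bβ = proj₂ (inverse b b≢0)
    β≢0 : β ≢ 0#
    β≢0 p = 𝟙≢𝟘 (trans (sym bβ) (*-zero-≡ p))
    br³ : b * cube (geometric t β) ≡ 1#
    br³ = trans (cong (b *_) (cube-cuberoot β≢0)) bβ

  module _ {b r : F} (b≢0 : b ≢ 0#) (r≢0 : r ≢ 0#) (br³ : b * cube r ≡ 1#)
           (r-unique : ∀ {w} → w ≢ 0# → b * cube w ≡ 1# → w ≡ r) where

    polar≡0⇒ : ∀ {w} → polar b w ≡ 0# → w ≡ 0# ⊎ w ≡ r
    polar≡0⇒ {w} p = zero-or-r (w ≟ᵥ 0#)
      where
      product≡0 : b * w * (b * cube w + 1#) ≡ 0#
      product≡0 = trans (sym (polar-sq b w)) (*-zero-≡ p)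
      zero-or-r : Dec (w ≡ 0#) → w ≡ 0# ⊎ w ≡ r
      zero-or-r (yes w≡0) = inj₁ w≡0
      zero-or-r (no w≢0)  = inj₂ (r-unique w≢0
        (+≡0⇒≡ (nonzero-cancel (λ bw≡0 → w≢0 (nonzero-cancel b≢0 bw≡0)) product≡0)))

    ⇒polar≡0 : ∀ {w} → w ≡ 0# ⊎ w ≡ r → polar b w ≡ 0#
    ⇒polar≡0 {w} w≡ = sq-injective (trans (polar-sq b w) (trans (zero′ w≡) (sym (zeroˡ 0#))))
      where
      zero′ : w ≡ 0# ⊎ w ≡ r → b * w * (b * cube w + 1#) ≡ 0#
      zero′ (inj₁ refl) = trans (cong (λ u → u * (b * cube 0# + 1#)) (zeroʳ b)) (zeroˡ _)
      zero′ (inj₂ refl) = *-zero-≡ (≡⇒+≡0 br³)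

    -- Only the radical `{0, r}` survives, each point with inner sum `q`; at 0 the exponent vanishes
    -- and the character is 1.
    S²-two-terms : ∀ u → S b u ℤ.* S b u ≡ q ℤ.+ χ (exponent b u r) ℤ.* q
    S²-two-terms u = begin
      S b u ℤ.* S b u        ≡⟨ S² b u ⟩
      sum term               ≡⟨ sum-two-points 0# r term (r≢0 ∘ sym) off ⟩
      term 0# ℤ.+ term r     ≡⟨ cong₂ ℤ._+_ (trans (on (inj₁ refl)) (trans (cong (ℤ._* q) χ-E0) (ℤₚ.*-identityˡ q)))
                                            (on (inj₂ refl)) ⟩
      q ℤ.+ χ (exponent b u r) ℤ.* q ∎
      where
      term : F → ℤ
      term w = χ (exponent b u w) ℤ.* sum (λ z → χ (polar b w * z))
      off : ∀ w → w ≢ 0# → w ≢ r → term w ≡ 0ℤ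
      off w w≢0 w≢r = trans (cong (λ c → χ (exponent b u w) ℤ.* c)
        (sum-χ-≢0 (λ p → Sum.[ w≢0 , w≢r ]′ (polar≡0⇒ p)))) (ℤₚ.*-zeroʳ (χ (exponent b u w)))
      on : ∀ {w} → w ≡ 0# ⊎ w ≡ r → term w ≡ χ (exponent b u w) ℤ.* q
      on {w} w≡ = cong (λ c → χ (exponent b u w) ℤ.* c) (sum-χ-0 (⇒polar≡0 w≡))
      χ-E0 : χ (exponent b u 0#) ≡ 1ℤ
      χ-E0 = trans (cong χ (trans (cong₂ _+_ (*-zero-≡ (zeroʳ _)) (zeroʳ u)) (+-identityˡ 0#))) χ-0

    S²-dichotomy : ∀ u → S b u ℤ.* S b u ≡ 0ℤ ⊎ S b u ℤ.* S b u ≡ q ℤ.+ q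
    S²-dichotomy u = Sum.swap (Sum.map
      (λ p → trans (substitute p) (cong (λ c → q ℤ.+ c) (ℤₚ.*-identityˡ q)))
      (λ p → trans (substitute p) (trans (cong (λ c → q ℤ.+ c) (ℤₚ.-1*i≡-i q)) (ℤₚ.+-inverseʳ q)))
      (χ-±1 (exponent b u r)))
      where
      substitute : ∀ {c} → χ (exponent b u r) ≡ c → S b u ℤ.* S b u ≡ q ℤ.+ c ℤ.* q
      substitute p = trans (S²-two-terms u) (cong (λ c → q ℤ.+ c ℤ.* q) p)

  S²-value : ∀ {b} → b ≢ 0# → ∀ u → S b u ℤ.* S b u ≡ 0ℤ ⊎ S b u ℤ.* S b u ≡ q ℤ.+ q
  S²-value b≢0 = let r , r≢0 , br³ , r-unique = inverse-cuberoot b≢0 in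
    S²-dichotomy b≢0 r≢0 br³ r-unique

  sum-χ-exponents : ∀ a b u v →
    sum (λ z → χ (exponent a u z) ℤ.* χ (exponent b v z)) ≡ S (a + b) (u + v)
  sum-χ-exponents a b u v = sum-cong (λ z → trans (sym (χ-+ _ _)) (cong χ
    (solve 5 (λ a b u v z → (a :* (z :* z :* z) :+ u :* z) :+ (b :* (z :* z :* z) :+ v :* z) :=
       (a :+ b) :* (z :* z :* z) :+ (u :+ v) :* z) refl a b u v z)))

  S-0-0 : S 0# 0# ≡ q
  S-0-0 = trans (sum-cong (λ z → cong χ (trans (cong (λ c → c + 0# * z) (zeroˡ (cube z))) (+-identityˡ _)))) (sum-χ-0 refl)

  S-0-≢0 : ∀ {u} → u ≢ 0# → S 0# u ≡ 0ℤ
  S-0-≢0 {u} u≢0 =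
    trans (sum-cong (λ z → cong χ (trans (cong (λ c → c + u * z) (zeroˡ (cube z))) (+-identityˡ _)))) (sum-χ-≢0 u≢0)

  -- Both factors are expanded and the sum over `v` is taken first; orthogonality forces `z = w`,
  -- where the cubic terms cancel. This gives the inner products of rows of `W_a W_bᵀ`.
  sum-S-S : ∀ b u u′ → sum (λ v → S b (u + v) ℤ.* S b (u′ + v)) ≡ q ℤ.* S 0# (u + u′)
  sum-S-S b u u′ = begin
    sum (λ v → S b (u + v) ℤ.* S b (u′ + v))
      ≡⟨ sum-cong (λ v → sum-*-sum (λ z → χ (exponent b (u + v) z)) (λ w → χ (exponent b (u′ + v) w))) ⟩
    sum (λ v → sum (λ z → sum (λ w → χ (exponent b (u + v) z) ℤ.* χ (exponent b (u′ + v) w))))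
      ≡⟨ sum-swap (λ v z → sum (λ w → χ (exponent b (u + v) z) ℤ.* χ (exponent b (u′ + v) w))) ⟩
    sum (λ z → sum (λ v → sum (λ w → χ (exponent b (u + v) z) ℤ.* χ (exponent b (u′ + v) w))))
      ≡⟨ sum-cong (λ z → sum-swap (λ v w → χ (exponent b (u + v) z) ℤ.* χ (exponent b (u′ + v) w))) ⟩
    sum (λ z → sum (λ w → sum (λ v → χ (exponent b (u + v) z) ℤ.* χ (exponent b (u′ + v) w))))
      ≡⟨ sum-cong (λ z → sum-cong (λ w → inner z w)) ⟩
    sum (λ z → sum (λ w → E z w ℤ.* sum (λ v → χ ((z + w) * v))))
      ≡⟨ sum-cong (λ z → sum-point z _ (λ w w≢z → off z w w≢z)) ⟩
    sum (λ z → E z z ℤ.* sum (λ v → χ ((z + z) * v)))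
      ≡⟨ sum-cong (λ z → trans (cong (λ c → E z z ℤ.* c) (sum-χ-0 (x+x≡0 z))) (ℤₚ.*-comm (E z z) q)) ⟩
    sum (λ z → q ℤ.* E z z)
      ≡⟨ sum-*ˡ q (λ z → E z z) ⟩
    q ℤ.* sum (λ z → E z z)
      ≡⟨ cong (λ c → q ℤ.* c) (trans (sum-χ-exponents b b u u′) (cong (λ c → S c (u + u′)) (x+x≡0 b))) ⟩
    q ℤ.* S 0# (u + u′) ∎
    where
    E : F → F → ℤ
    E z w = χ (exponent b u z) ℤ.* χ (exponent b u′ w)
    inner : ∀ z w → sum (λ v → χ (exponent b (u + v) z) ℤ.* χ (exponent b (u′ + v) w)) ≡
                    E z w ℤ.* sum (λ v → χ ((z + w) * v))
    inner z w = trans (sum-cong (λ v → begin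
      χ (exponent b (u + v) z) ℤ.* χ (exponent b (u′ + v) w)
        ≡⟨ sym (χ-+ _ _) ⟩
      χ (exponent b (u + v) z + exponent b (u′ + v) w)
        ≡⟨ cong χ (solve 6 (λ b u u′ v z w →
             (b :* (z :* z :* z) :+ (u :+ v) :* z) :+ (b :* (w :* w :* w) :+ (u′ :+ v) :* w) :=
             ((b :* (z :* z :* z) :+ u :* z) :+ (b :* (w :* w :* w) :+ u′ :* w)) :+ (z :+ w) :* v)
             refl b u u′ v z w) ⟩
      χ ((exponent b u z + exponent b u′ w) + (z + w) * v)
        ≡⟨ χ-+ _ _ ⟩
      χ (exponent b u z + exponent b u′ w) ℤ.* χ ((z + w) * v)
        ≡⟨ cong (ℤ._* χ ((z + w) * v)) (χ-+ _ _) ⟩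
      E z w ℤ.* χ ((z + w) * v) ∎))
      (sum-*ˡ (E z w) (λ v → χ ((z + w) * v)))
    off : ∀ z w → w ≢ z → E z w ℤ.* sum (λ v → χ ((z + w) * v)) ≡ 0ℤ
    off z w w≢z = trans (cong (λ c → E z w ℤ.* c) (sum-χ-≢0 (λ p → w≢z (sym (+≡0⇒≡ p))))) (ℤₚ.*-zeroʳ (E z w))

-- The weighing matrices

≡scalarId : ∀ {d} k (i j : Fin d) {x} → (i ≡ j → x ≡ k) → (i ≢ j → x ≡ 0ℤ) → x ≡ scalarId k i j
≡scalarId k i j diag off with i Fin.≟ j
... | yes p = diag p
... | no p  = off p

x²≡y²⇒x≡±y : ∀ x y → x ℤ.* x ≡ y ℤ.* y → x ≡ y ⊎ x ≡ ℤ.- y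
x²≡y²⇒x≡±y x y p = Sum.map (ℤₚ.i-j≡0⇒i≡j x y)
  (λ q → ℤₚ.i-j≡0⇒i≡j x (ℤ.- y) (trans (cong (λ z → x ℤ.+ z) (ℤₚ.neg-involutive y)) q))
  (ℤₚ.i*j≡0⇒i≡0∨j≡0 (x ℤ.- y) (begin
    (x ℤ.- y) ℤ.* (x ℤ.+ y)    ≡⟨ difference x y ⟩
    x ℤ.* x ℤ.- y ℤ.* y        ≡⟨ ℤₚ.i≡j⇒i-j≡0 p ⟩
    0ℤ                         ∎))
  where
  open ≡-Reasoning
  difference : ∀ x y → (x ℤ.- y) ℤ.* (x ℤ.+ y) ≡ x ℤ.* x ℤ.- y ℤ.* y
  difference = solve 2 (λ x y → (x :- y) :* (x :+ y) := x :* x :- y :* y) refl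
    where open ℤ-Solver

-- The square determines `x` up to sign, so `x` is 0 or `±s`.
scaled-trit : ∀ s x → x ℤ.* x ≡ 0ℤ ⊎ x ℤ.* x ≡ s ℤ.* s → ∃ λ y → Trit y × x ≡ s ℤ.* y
scaled-trit s x (inj₁ p) = 0ℤ , inj₁ refl ,
  trans (Sum.[ id , id ]′ (ℤₚ.i*j≡0⇒i≡0∨j≡0 x p)) (sym (ℤₚ.*-zeroʳ s))
scaled-trit s x (inj₂ p) with x²≡y²⇒x≡±y x s p
... | inj₁ q = 1ℤ  , inj₂ (inj₁ refl) , trans q (sym (ℤₚ.*-identityʳ s))
... | inj₂ q = -1ℤ , inj₂ (inj₂ refl) , trans q (trans (sym (ℤₚ.-1*i≡-i s)) (ℤₚ.*-comm -1ℤ s))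

*-pull-scalars : ∀ s x y → s ℤ.* (s ℤ.* (x ℤ.* y)) ≡ (s ℤ.* x) ℤ.* (s ℤ.* y)
*-pull-scalars = solve 3 (λ s x y → s :* (s :* (x :* y)) := (s :* x) :* (s :* y)) refl
  where open ℤ-Solver

module Matrices (t : ℕ) (𝔽 : BinaryField (suc (t ℕ.* 2))) where
  open Field 𝔽
  open OddDegree t 𝔽
  open ≡-Reasoning

  private
    m d h s : ℕ
    m = suc (t ℕ.* 2)
    d = 2 ℕ.^ m
    h = 2 ℕ.^ (t ℕ.* 2)
    s = 2 ℕ.^ suc t

    ⟦_⟧ : Fin d → F
    ⟦_⟧ = bits m

  -- As `m` is odd, `2d = 2^(m+1)` has an even exponent, and `s = 2^(t+1)` is its exact square root.
  s*s≡2*d : s ℕ.* s ≡ 2 ℕ.* d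
  s*s≡2*d = begin
    s ℕ.* s                   ≡⟨ cong (s ℕ.*_) (sym (ℕₚ.*-identityʳ s)) ⟩
    s ℕ.^ 2                   ≡⟨ ℕₚ.^-*-assoc 2 (suc t) 2 ⟩
    2 ℕ.^ (suc t ℕ.* 2)       ∎

  s²≡q+q : + s ℤ.* + s ≡ q ℤ.+ q
  s²≡q+q = begin
    + s ℤ.* + s             ≡⟨ sym (ℤₚ.pos-* s s) ⟩
    + (s ℕ.* s)             ≡⟨ cong +_ s*s≡2*d ⟩
    + (d ℕ.+ (d ℕ.+ 0))     ≡⟨ cong (λ n → + (d ℕ.+ n)) (ℕₚ.+-identityʳ d) ⟩
    + (d ℕ.+ d)             ≡⟨ ℤₚ.pos-+ d d ⟩
    q ℤ.+ q                 ∎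

  q≡h+h : q ≡ + h ℤ.+ + h
  q≡h+h = trans (cong (λ n → + (h ℕ.+ n)) (ℕₚ.+-identityʳ h)) (ℤₚ.pos-+ h h)

  -- Identifies the weight: `s²` times the diagonal of `M Mᵀ` is `q²`, and `s² = 2q` leaves
  -- `h = q/2`.
  s²*h≡q² : + s ℤ.* (+ s ℤ.* + h) ≡ q ℤ.* q
  s²*h≡q² = begin
    + s ℤ.* (+ s ℤ.* + h)    ≡⟨ sym (ℤₚ.*-assoc (+ s) (+ s) (+ h)) ⟩
    (+ s ℤ.* + s) ℤ.* + h    ≡⟨ cong (ℤ._* + h) s²≡q+q ⟩
    (q ℤ.+ q) ℤ.* + h        ≡⟨ ℤₚ.*-distribʳ-+ (+ h) q q ⟩
    q ℤ.* + h ℤ.+ q ℤ.* + h  ≡⟨ sym (ℤₚ.*-distribˡ-+ q (+ h) (+ h)) ⟩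
    q ℤ.* (+ h ℤ.+ + h)      ≡⟨ cong (q ℤ.*_) (sym q≡h+h) ⟩
    q ℤ.* q                  ∎

  d/2≡h : d ℕ./ 2 ≡ h
  d/2≡h = trans (cong (ℕ._/ 2) (ℕₚ.*-comm 2 h)) (DivMod.m*n/n≡m h 2)

  cancel-s² : ∀ {x y} → + s ℤ.* (+ s ℤ.* x) ≡ + s ℤ.* (+ s ℤ.* y) → x ≡ y
  cancel-s² p = ℤₚ.*-cancelˡ-≡ (+ s) _ _ (ℤₚ.*-cancelˡ-≡ (+ s) _ _ p)
    where instance _ = ℕₚ.m^n≢0 2 (suc t)

  W : Fin d → Matrix d
  W a u z = χ (exponent ⟦ a ⟧ ⟦ u ⟧ ⟦ z ⟧)

  W·Wᵀ : ∀ a b i j → (W a · transpose (W b)) i j ≡ S (⟦ a ⟧ + ⟦ b ⟧) (⟦ i ⟧ + ⟦ j ⟧)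
  W·Wᵀ a b i j = trans (∑-bits m (λ z → χ (exponent ⟦ a ⟧ ⟦ i ⟧ z) ℤ.* χ (exponent ⟦ b ⟧ ⟦ j ⟧ z)))
                       (sum-χ-exponents ⟦ a ⟧ ⟦ b ⟧ ⟦ i ⟧ ⟦ j ⟧)

  bits-+≢0 : ∀ {i j} → i ≢ j → ⟦ i ⟧ + ⟦ j ⟧ ≢ 0#
  bits-+≢0 i≢j p = i≢j (bits-injective m (+≡0⇒≡ p))

  S-0-diagonal : ∀ {i j} → i ≡ j → S 0# (⟦ i ⟧ + ⟦ j ⟧) ≡ q
  S-0-diagonal {i} refl = trans (cong (S 0#) (x+x≡0 ⟦ i ⟧)) S-0-0

  S-0-off-diagonal : ∀ {i j} → i ≢ j → S 0# (⟦ i ⟧ + ⟦ j ⟧) ≡ 0ℤ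
  S-0-off-diagonal i≢j = S-0-≢0 (bits-+≢0 i≢j)

  W-isWeighing : ∀ a → IsWeighing d d (W a)
  W-isWeighing a = (λ i j → inj₂ (χ-±1 _)) , λ i j →
    let W·Wᵀ₀ = trans (W·Wᵀ a a i j) (cong (λ c → S c (⟦ i ⟧ + ⟦ j ⟧)) (x+x≡0 ⟦ a ⟧)) in
    ≡scalarId q i j (λ p → trans W·Wᵀ₀ (S-0-diagonal p)) (λ p → trans W·Wᵀ₀ (S-0-off-diagonal p))

  module _ (a b : Fin d) (a≢b : a ≢ b) where

    private
      c : F
      c = ⟦ a ⟧ + ⟦ b ⟧

    S-scaled-trit : ∀ u → ∃ λ y → Trit y × S c u ≡ + s ℤ.* y
    S-scaled-trit u = scaled-trit (+ s) (S c u)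
      (Sum.map₂ (λ p → trans p (sym s²≡q+q)) (S²-value (bits-+≢0 a≢b) u))

    M : Matrix d
    M i j = proj₁ (S-scaled-trit (⟦ i ⟧ + ⟦ j ⟧))

    S≡s*M : ∀ i j → S c (⟦ i ⟧ + ⟦ j ⟧) ≡ + s ℤ.* M i j
    S≡s*M i j = proj₂ (proj₂ (S-scaled-trit (⟦ i ⟧ + ⟦ j ⟧)))

    -- `M` is `S c` divided by `s`. Multiplying by `s²` replaces that division, turning the entries
    -- back into character sums so that `sum-S-S` applies; `cancel-s²` removes the factor
    -- afterwards.
    s²*M·Mᵀ : ∀ i j → + s ℤ.* (+ s ℤ.* (M · transpose M) i j) ≡ q ℤ.* S 0# (⟦ i ⟧ + ⟦ j ⟧)
    s²*M·Mᵀ i j = begin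
      + s ℤ.* (+ s ℤ.* ∑ (λ l → M i l ℤ.* M j l))
        ≡⟨ cong (+ s ℤ.*_) (sym (∑-*ˡ (+ s) (λ l → M i l ℤ.* M j l))) ⟩
      + s ℤ.* ∑ (λ l → + s ℤ.* (M i l ℤ.* M j l))
        ≡⟨ sym (∑-*ˡ (+ s) (λ l → + s ℤ.* (M i l ℤ.* M j l))) ⟩
      ∑ (λ l → + s ℤ.* (+ s ℤ.* (M i l ℤ.* M j l)))
        ≡⟨ ∑-cong (λ l → *-pull-scalars (+ s) (M i l) (M j l)) ⟩
      ∑ (λ l → (+ s ℤ.* M i l) ℤ.* (+ s ℤ.* M j l))
        ≡⟨ ∑-cong (λ l → sym (cong₂ ℤ._*_ (S≡s*M i l) (S≡s*M j l))) ⟩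
      ∑ (λ l → S c (⟦ i ⟧ + ⟦ l ⟧) ℤ.* S c (⟦ j ⟧ + ⟦ l ⟧))
        ≡⟨ ∑-bits m (λ v → S c (⟦ i ⟧ + v) ℤ.* S c (⟦ j ⟧ + v)) ⟩
      sum (λ v → S c (⟦ i ⟧ + v) ℤ.* S c (⟦ j ⟧ + v))
        ≡⟨ sum-S-S c ⟦ i ⟧ ⟦ j ⟧ ⟩
      q ℤ.* S 0# (⟦ i ⟧ + ⟦ j ⟧) ∎

    M-isWeighing : IsWeighing d (d ℕ./ 2) M
    M-isWeighing = (λ i j → proj₁ (proj₂ (S-scaled-trit (⟦ i ⟧ + ⟦ j ⟧)))) , λ i j →
      ≡scalarId (+ (d ℕ./ 2)) i j
        (λ p → trans (cancel-s² (trans (s²*M·Mᵀ i j) (trans (cong (q ℤ.*_) (S-0-diagonal p)) (sym s²*h≡q²))))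
                     (cong +_ (sym d/2≡h)))
        (λ p → cancel-s² (trans (s²*M·Mᵀ i j) (trans (cong (q ℤ.*_) (S-0-off-diagonal p))
                     (trans (ℤₚ.*-zeroʳ q) (sym (trans (cong (+ s ℤ.*_) (ℤₚ.*-zeroʳ (+ s))) (ℤₚ.*-zeroʳ (+ s))))))))

    W-quasiUnbiased : QuasiUnbiased d d (d ℕ./ 2) (2 ℕ.* d) (W a) (W b)
    W-quasiUnbiased = s , s*s≡2*d , M , M-isWeighing , λ i j → trans (W·Wᵀ a b i j) (S≡s*M i j)

  W-isMQUWM : IsMQUWM d d d (d ℕ./ 2) (2 ℕ.* d) W
  W-isMQUWM = W-isWeighing , W-quasiUnbiased

open import Data.Nat using (ℕ; _*_; _+_; _^_; _/_; _≥_)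
open import Data.Fin using (Fin)
open import Data.Product using (Σ)

theorem4p4 : (t : ℕ) → t ≥ 1 →
    Σ (Fin (2 ^ (2 * t + 1)) → Matrix (2 ^ (2 * t + 1))) λ W →
    IsMQUWM (2 ^ (2 * t + 1)) (2 ^ (2 * t + 1)) (2 ^ (2 * t + 1))
    ((2 ^ (2 * t + 1)) / 2) (2 * 2 ^ (2 * t + 1)) W
-- The construction uses the exponent in the form `suc (t * 2)`, on which the recursions compute;
-- the result is transported to `2 * t + 1`.
theorem4p4 t _ = subst MQUWM (trans (cong suc (ℕₚ.*-comm t 2)) (ℕₚ.+-comm 1 (2 * t))) (W , W-isMQUWM)
  where
  open Matrices t (binaryField (t * 2))
  MQUWM : ℕ → Set
  MQUWM n = Σ (Fin (2 ^ n) → Matrix (2 ^ n)) λ W →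
    IsMQUWM (2 ^ n) (2 ^ n) (2 ^ n) ((2 ^ n) / 2) (2 * 2 ^ n) W
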